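{- Let $G=(V,E)$ be a graph with $n\ge 4$ vertices and maximum degree $\Delta(G)=n-2$. If $|E|=m\le 2n-5$, then $G$ is antimagic.
   Context: All graphs are finite, undirected and simple; $\Delta(G)$ denotes the maximum degree of $G$. An antimagic labeling of a graph with $m$ edges and $n$ vertices is a bijection from the set of edges to the integers $\{1,\ldots,m\}$ such that all $n$ vertex sums are pairwise distinct, where a vertex sum is the sum of the labels of all edges incident with that vertex (an isolated vertex has vertex sum $0$). A graph is called antimagic if it has an antimagic labeling. -}

module Defs where

open import Data.Fin using (Fin; toℕ; _<_; _<?_; _≟_)
open import Data.List using (List; length; map; filter; mapMaybe; allFin; cartesianProduct)
open import Data.List.Extrema.Nat using (max)
open import Data.Maybe using (Maybe; just; nothing)
open import Data.Nat using (ℕ; suc)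
open import Data.Nat.ListAction using (sum)
open import Data.Product using (∃; _×_; _,_)
open import Data.Sum using (_⊎_)
open import Function using (_∘_)
open import Function.Bundles using (_⤖_; module Bijection)
open import Function.Definitions using (Injective)
open import Level using (0ℓ)
open import Relation.Binary.Core using (Rel)
open import Relation.Binary.Definitions using (Symmetric; Irreflexive; Decidable)
open import Relation.Binary.PropositionalEquality using (_≡_)
open import Relation.Nullary.Decidable using (Dec; yes; no; _⊎-dec_)

-- Finite simple graphs on the vertex set Fin n.
record Graph (n : ℕ) : Set₁ where
  infix 4 _~_ _~?_
  field
    _~_      : Rel (Fin n) 0ℓ
    _~?_     : Decidable _~_
    ~-sym    : Symmetric _~_
    ~-irrefl : Irreflexive _≡_ _~_

module _ {n : ℕ} (G : Graph n) where
  open Graph G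

  degree : Fin n → ℕ
  degree v = length (filter (v ~?_) (allFin n))

  -- The base value 0 matters only for the graph with no vertices.
  Δ : ℕ
  Δ = max 0 (map degree (allFin n))

  -- An undirected edge is represented by its endpoints in increasing order.
  -- The proofs are irrelevant, so propositional equality of edges is
  -- equality of both endpoints.
  record Edge : Set where
    constructor edge
    field
      lo hi  : Fin n
      .lo<hi : lo < hi
      .lo~hi : lo ~ hi

  toEdge : Fin n × Fin n → Maybe Edge
  toEdge (u , v) with u <? v | u ~? v
  ... | yes u<v | yes u~v = just (edge u v u<v u~v)
  ... | yes _   | no  _   = nothing
  ... | no  _   | _       = nothing

  -- Every edge occurs exactly once.
  edges : List Edge
  edges = mapMaybe toEdge (cartesianProduct (allFin n) (allFin n))

  ∣E∣ : ℕ
  ∣E∣ = length edges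

  Incident : Fin n → Edge → Set
  Incident v e = v ≡ Edge.lo e ⊎ v ≡ Edge.hi e

  incident? : (v : Fin n) (e : Edge) → Dec (Incident v e)
  incident? v e = (v ≟ Edge.lo e) ⊎-dec (v ≟ Edge.hi e)

  -- Bijections from the edges to {1, …, ∣E∣}; i : Fin ∣E∣ stands for the
  -- label suc (toℕ i).
  Labeling : Set
  Labeling = Edge ⤖ Fin ∣E∣

  label : Labeling → Edge → ℕ
  label f = suc ∘ toℕ ∘ Bijection.to f

  vertexSum : Labeling → Fin n → ℕ
  vertexSum f v = sum (map (label f) (filter (incident? v) edges))

  IsAntimagicLabeling : Labeling → Set
  IsAntimagicLabeling f = Injective _≡_ _≡_ (vertexSum f)

  Antimagic : Set
  Antimagic = ∃ IsAntimagicLabeling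

{-# OPTIONS --safe #-}
-- Let v have degree n − 2, let w be its only non-neighbour, U the neighbourhood of v and H the set of the k
-- edges avoiding v, so that t = ∣U∣ − k ≥ 1 and m = 2k + t.  Once H is labelled, the edges at v get the remaining
-- labels in the order of the partial sums (over H) of their ends, which makes the vertex sums on U distinct;
-- it remains to separate them from w and v.
-- If w has degree at most 1, the labels 1, …, k for H do: the sum at w is at most k, and those on U exceed k.
-- If w has degree at least 2 and t is odd, H gets the even labels 2k + t − 1, …, t + 1.  A vertex of U whose
-- label at v is even has a label below t; as fewer than k vertices have a partial sum above 2k + t − 1
-- (they have degree at least 2 in H), its vertex sum is too small to be that of w, whereas odd labels at v give odd
-- sums and the sum at w is even.  Putting the two largest labels of H at w bounds the partial sums on U, hence
-- makes the sum at v the largest, except for the 4-cycle with a pendant edge.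
-- If t is even, one neighbour x of v that is adjacent to w gets the label m on its edge to v, and the rest is
-- labelled in the same way with t − 1 in place of t.
module Submission where

open import Defs
open import Data.Bool using (true; false)
open import Data.Empty using (⊥-elim-irr)
open import Data.Fin as Fin using (Fin; toℕ; fromℕ<; _≟_)
import Data.Fin.Properties as Finₚ
open import Data.List using (List; []; _∷_; _++_; map; filter; length; upTo; [_]; mapMaybe; allFin)
open import Data.List.Extrema.Nat using (argmax-sel)
open import Data.List.Membership.Propositional using (_∈_; _∉_)
open import Data.List.Membership.Propositional.Properties
open import Data.List.Properties
  using (map-++; map-∘; length-map; length-upTo; length-tabulate; length-++; upTo-∷ʳ; ++-identityʳ;
         filter-++; filter-accept; filter-reject; filter-none; filter-notAll)
open import Data.List.Relation.Binary.Permutation.Propositional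
  using (_↭_; ↭-refl; ↭-reflexive; ↭-sym; ↭-trans; ↭-swap; prep; ↭⇒↭ₛ)
open import Data.List.Relation.Binary.Permutation.Propositional.Properties
  using (shift; ↭-length; map⁺; ∈-resp-↭; filter-↭; ++⁺ˡ)
import Data.List.Relation.Binary.Permutation.Setoid.Properties as Permₛ
open import Data.List.Relation.Binary.Subset.Propositional using (_⊆_)
open import Data.List.Relation.Unary.All as All using (All; []; _∷_)
open import Data.List.Relation.Unary.AllPairs using ([]; _∷_)
open import Data.List.Relation.Unary.Any as Any using (here; there)
import Data.List.Relation.Unary.Any.Properties as Anyₚ
open import Data.List.Relation.Unary.Unique.Propositional using (Unique)
import Data.List.Relation.Unary.Unique.Propositional.Properties as Unique
open import Data.Maybe using (Maybe; just; nothing)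
open import Data.Maybe.Relation.Unary.Any as MAny using (just)
open import Data.Nat as ℕ hiding (_≟_)
open import Data.Nat.Divisibility using (_∣_; divides; m∣m*n; _∣0; ∣1⇒≡1; ∣m∣n⇒∣m+n; ∣m+n∣m⇒∣n)
open import Data.Nat.ListAction using (sum)
open import Data.Nat.ListAction.Properties using (sum-++; sum-↭)
open import Data.Nat.Properties hiding (_≟_)
open import Algebra.Properties.CommutativeSemigroup +-commutativeSemigroup using (x∙yz≈y∙xz)
open import Data.Nat.Tactic.RingSolver using (solve-∀)
open import Data.Product using (∃; _×_; _,_; proj₁; proj₂)
open import Data.Sum using (_⊎_; inj₁; inj₂)
open import Function using (_∘_; Injective)
open import Function.Bundles using (mk⤖)
open import Level using (0ℓ)
open import Relation.Binary.Definitions using (DecidableEquality; tri<; tri≈; tri>)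
open import Relation.Binary.PropositionalEquality
  using (_≡_; _≢_; refl; sym; trans; cong; cong₂; subst; subst₂; setoid; module ≡-Reasoning)
open import Relation.Nullary using (Dec; ¬_; yes; no; does; contradiction)
open import Relation.Nullary.Decidable using (recompute; _×-dec_; map′)
open import Relation.Unary using (Pred; Decidable)
open import Relation.Unary.Properties using (∁?)

private variable
  A B : Set

-- Sums and counts over lists

∑ : (A → ℕ) → List A → ℕ
∑ f xs = sum (map f xs)

∑-++ : (f : A → ℕ) (xs ys : List A) → ∑ f (xs ++ ys) ≡ ∑ f xs + ∑ f ys
∑-++ f xs ys = trans (cong sum (map-++ f xs ys)) (sum-++ (map f xs) (map f ys))

∑-↭ : (f : A → ℕ) {xs ys : List A} → xs ↭ ys → ∑ f xs ≡ ∑ f ys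
∑-↭ f p = sum-↭ (map⁺ f p)

∑-cong : {f g : A → ℕ} (xs : List A) → (∀ {x} → x ∈ xs → f x ≡ g x) → ∑ f xs ≡ ∑ g xs
∑-cong []       eq = refl
∑-cong (x ∷ xs) eq = cong₂ _+_ (eq (here refl)) (∑-cong xs (eq ∘ there))

∑-mono-≤ : {f g : A → ℕ} (xs : List A) → (∀ {x} → x ∈ xs → f x ≤ g x) → ∑ f xs ≤ ∑ g xs
∑-mono-≤ []       le = z≤n
∑-mono-≤ (x ∷ xs) le = +-mono-≤ (le (here refl)) (∑-mono-≤ xs (le ∘ there))

∑-const : (c : ℕ) (xs : List A) → ∑ (λ _ → c) xs ≡ length xs * c
∑-const c []       = refl
∑-const c (x ∷ xs) = cong (c +_) (∑-const c xs)

∑≤length* : {f : A → ℕ} {c : ℕ} (xs : List A) → (∀ {x} → x ∈ xs → f x ≤ c) → ∑ f xs ≤ length xs * c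
∑≤length* {c = c} xs le = ≤-trans (∑-mono-≤ xs le) (≤-reflexive (∑-const c xs))

length*≤∑ : {f : A → ℕ} {c : ℕ} (xs : List A) → (∀ {x} → x ∈ xs → c ≤ f x) → length xs * c ≤ ∑ f xs
length*≤∑ {c = c} xs le = ≤-trans (≤-reflexive (sym (∑-const c xs))) (∑-mono-≤ xs le)

∑-upTo-suc : (f : ℕ → ℕ) (n : ℕ) → ∑ f (upTo (suc n)) ≡ ∑ f (upTo n) + f n
∑-upTo-suc f n = begin
  ∑ f (upTo (suc n))       ≡⟨ cong (∑ f) (sym (upTo-∷ʳ n)) ⟩
  ∑ f (upTo n ++ [ n ])    ≡⟨ ∑-++ f (upTo n) [ n ] ⟩
  ∑ f (upTo n) + (f n + 0) ≡⟨ cong (∑ f (upTo n) +_) (+-identityʳ (f n)) ⟩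
  ∑ f (upTo n) + f n       ∎
  where open ≡-Reasoning

∑-upTo-mono : (f : ℕ → ℕ) {m n : ℕ} → m ≤ n → ∑ f (upTo m) ≤ ∑ f (upTo n)
∑-upTo-mono f m≤n = go (≤⇒≤′ m≤n)
  where
  go : ∀ {m n} → m ≤′ n → ∑ f (upTo m) ≤ ∑ f (upTo n)
  go ≤′-refl               = ≤-refl
  go {n = suc n} (≤′-step p) = ≤-trans (go p) (≤-trans (m≤m+n _ (f n)) (≤-reflexive (sym (∑-upTo-suc f n))))

module _ {P : Pred A 0ℓ} (P? : Decidable P) (f : A → ℕ) where

  ∑-filter-≤ : ∀ xs → ∑ f (filter P? xs) ≤ ∑ f xs
  ∑-filter-≤ [] = z≤n
  ∑-filter-≤ (x ∷ xs) with P? x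
  ... | yes _ = +-monoʳ-≤ (f x) (∑-filter-≤ xs)
  ... | no  _ = m≤n⇒m≤o+n (f x) (∑-filter-≤ xs)

  ∑-filter-omit : ∀ {xs x} → x ∈ xs → ¬ P x → ∑ f (filter P? xs) + f x ≤ ∑ f xs
  ∑-filter-omit {y ∷ xs} {x} (here refl) ¬p with P? y
  ... | yes p = contradiction p ¬p
  ... | no  _ = ≤-trans (≤-reflexive (+-comm _ (f y))) (+-monoʳ-≤ (f y) (∑-filter-≤ xs))
  ∑-filter-omit {y ∷ xs} {x} (there i) ¬p with P? y
  ... | yes _ = ≤-trans (≤-reflexive (+-assoc (f y) _ _)) (+-monoʳ-≤ (f y) (∑-filter-omit i ¬p))
  ... | no  _ = m≤n⇒m≤o+n (f y) (∑-filter-omit i ¬p)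

module _ {P Q : Pred A 0ℓ} (P? : Decidable P) (Q? : Decidable Q) where

  length-filter-mono : ∀ xs → (∀ {x} → x ∈ xs → P x → Q x) →
                       length (filter P? xs) ≤ length (filter Q? xs)
  length-filter-mono [] P⇒Q = z≤n
  length-filter-mono (x ∷ xs) P⇒Q with P? x | Q? x
  ... | yes p | yes q = s≤s (length-filter-mono xs (P⇒Q ∘ there))
  ... | yes p | no ¬q = contradiction (P⇒Q (here refl) p) ¬q
  ... | no ¬p | yes q = m≤n⇒m≤1+n (length-filter-mono xs (P⇒Q ∘ there))
  ... | no ¬p | no ¬q = length-filter-mono xs (P⇒Q ∘ there)

  length-filter-mono-< : ∀ {xs x} → (∀ {y} → y ∈ xs → P y → Q y) → x ∈ xs → ¬ P x → Q x →
                         length (filter P? xs) < length (filter Q? xs)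
  length-filter-mono-< {x ∷ xs} P⇒Q (here refl) ¬p q with P? x | Q? x
  ... | yes p | _     = contradiction p ¬p
  ... | no  _ | no ¬q = contradiction q ¬q
  ... | no  _ | yes _ = s≤s (length-filter-mono xs (P⇒Q ∘ there))
  length-filter-mono-< {y ∷ xs} P⇒Q (there i) ¬p q with P? y | Q? y
  ... | yes p | yes _ = s≤s (length-filter-mono-< (P⇒Q ∘ there) i ¬p q)
  ... | yes p | no ¬q = contradiction (P⇒Q (here refl) p) ¬q
  ... | no  _ | yes _ = m≤n⇒m≤1+n (length-filter-mono-< (P⇒Q ∘ there) i ¬p q)
  ... | no  _ | no  _ = length-filter-mono-< (P⇒Q ∘ there) i ¬p q

*-length-filter-≤-∑ : {P : Pred A 0ℓ} (P? : Decidable P) (f : A → ℕ) (b : ℕ) (xs : List A) →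
                      (∀ {x} → x ∈ xs → P x → b ≤ f x) → length (filter P? xs) * b ≤ ∑ f xs
*-length-filter-≤-∑ P? f b [] le = z≤n
*-length-filter-≤-∑ P? f b (x ∷ xs) le with P? x
... | yes p = +-mono-≤ (le (here refl) p) (*-length-filter-≤-∑ P? f b xs (le ∘ there))
... | no  _ = m≤n⇒m≤o+n (f x) (*-length-filter-≤-∑ P? f b xs (le ∘ there))

module _ {R : A → B → Set} (R? : ∀ x y → Dec (R x y)) where

  private
    ∑-length-filter-∷ : ∀ xs y ys →
      ∑ (λ x → length (filter (R? x) (y ∷ ys))) xs ≡
      length (filter (λ x → R? x y) xs) + ∑ (λ x → length (filter (R? x) ys)) xs
    ∑-length-filter-∷ [] y ys = refl
    ∑-length-filter-∷ (x ∷ xs) y ys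
      with ih ← ∑-length-filter-∷ xs y ys | eq ← x∙yz≈y∙xz (length (filter (R? x) ys))
             (length (filter (λ x → R? x y) xs)) (∑ (λ x → length (filter (R? x) ys)) xs) | does (R? x y)
    ... | true  = cong suc (trans (cong (length (filter (R? x) ys) +_) ih) eq)
    ... | false = trans (cong (length (filter (R? x) ys) +_) ih) eq

  double-counting : ∀ xs ys → ∑ (λ x → length (filter (R? x) ys)) xs ≡
                              ∑ (λ y → length (filter (λ x → R? x y) xs)) ys
  double-counting xs []       = trans (∑-const 0 xs) (*-zeroʳ (length xs))
  double-counting xs (y ∷ ys) = trans (∑-length-filter-∷ xs y ys)
    (cong (length (filter (λ x → R? x y) xs) +_) (double-counting xs ys))

-- Duplicate-free lists

⊆⇒↭++ : {xs ys : List A} → Unique xs → xs ⊆ ys → ∃ λ zs → ys ↭ xs ++ zs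
⊆⇒↭++ {xs = []} {ys} _ _ = ys , ↭-refl
⊆⇒↭++ {xs = x ∷ xs} {ys} (x∉ ∷ u) xs⊆ys with ∈-∃++ (xs⊆ys (here refl))
... | as , bs , refl with ⊆⇒↭++ u xs⊆as++bs
  where
  xs⊆as++bs : xs ⊆ as ++ bs
  xs⊆as++bs i with ∈-resp-↭ (shift x as bs) (xs⊆ys (there i))
  ... | here refl = contradiction refl (All.lookup x∉ i)
  ... | there j   = j
... | zs , p = zs , ↭-trans (shift x as bs) (prep x p)

⊆⇒length≤ : {xs ys : List A} → Unique xs → xs ⊆ ys → length xs ≤ length ys
⊆⇒length≤ {xs = xs} u s with ⊆⇒↭++ u s
... | zs , p = ≤-trans (m≤m+n _ (length zs)) (≤-reflexive (sym (trans (↭-length p) (length-++ xs))))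

⊆∧length≥⇒↭ : {xs ys : List A} → Unique xs → xs ⊆ ys → length ys ≤ length xs → xs ↭ ys
⊆∧length≥⇒↭ {xs = xs} {ys} u s le with ⊆⇒↭++ u s
... | [] , p = ↭-sym (↭-trans p (↭-reflexive (++-identityʳ xs)))
... | z ∷ zs , p = contradiction le (<⇒≱ (≤-trans
        (subst (length xs <_) (sym (+-suc (length xs) (length zs))) (s≤s (m≤m+n _ _)))
        (≤-reflexive (sym (trans (↭-length p) (length-++ xs))))))

⊆∧⊇⇒↭ : {xs ys : List A} → Unique xs → Unique ys → xs ⊆ ys → ys ⊆ xs → xs ↭ ys
⊆∧⊇⇒↭ ux uy s t = ⊆∧length≥⇒↭ ux s (⊆⇒length≤ uy t)

Unique-map-local : {f : A → B} {xs : List A} → Unique xs →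
                   (∀ {x y} → x ∈ xs → y ∈ xs → f x ≡ f y → x ≡ y) → Unique (map f xs)
Unique-map-local {xs = []} u inj = []
Unique-map-local {f = f} {xs = x ∷ xs} (x∉ ∷ u) inj =
  All.tabulate (λ i → λ where refl → case i) ∷ Unique-map-local u (λ i j → inj (there i) (there j))
  where
  case : f x ∉ map f xs
  case i with ∈-map⁻ f i
  ... | y , y∈ , eq = All.lookup x∉ y∈ (inj (here refl) (there y∈) eq)

∑-reindex : {f : A → ℕ} {xs : List A} → Unique xs →
            (∀ {x y} → x ∈ xs → y ∈ xs → f x ≡ f y → x ≡ y) →
            (∀ {x} → x ∈ xs → f x < length xs) →
            (g : ℕ → ℕ) → ∑ (g ∘ f) xs ≡ ∑ g (upTo (length xs))
∑-reindex {f = f} {xs} u inj bound g = trans (cong sum (map-∘ xs)) (∑-↭ g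
  (⊆∧length≥⇒↭ (Unique-map-local u inj) into
    (≤-reflexive (trans (length-upTo (length xs)) (sym (length-map f xs))))))
  where
  into : map f xs ⊆ upTo (length xs)
  into i with ∈-map⁻ f i
  ... | x , x∈ , refl = ∈-upTo⁺ (bound x∈)

Unique-resp-↭ : {xs ys : List A} → xs ↭ ys → Unique xs → Unique ys
Unique-resp-↭ {A = A} p = Permₛ.Unique-resp-↭ (setoid A) (↭⇒↭ₛ p)

filter-∁-↭ : {P : Pred A 0ℓ} (P? : Decidable P) (xs : List A) → xs ↭ filter P? xs ++ filter (∁? P?) xs
filter-∁-↭ P? [] = ↭-refl
filter-∁-↭ P? (x ∷ xs) with does (P? x)
... | true  = prep x (filter-∁-↭ P? xs)
... | false = ↭-trans (prep x (filter-∁-↭ P? xs)) (↭-sym (shift x _ _))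

Unique-mapMaybe : {f : A → Maybe B} → (∀ {x x′ y} → f x ≡ just y → f x′ ≡ just y → x ≡ x′) →
                  {xs : List A} → Unique xs → Unique (mapMaybe f xs)
Unique-mapMaybe inj [] = []
Unique-mapMaybe {A = A} {f = f} inj {x ∷ xs} (x∉ ∷ u) with f x in eq
... | nothing = Unique-mapMaybe inj u
... | just y  = go eq xs x∉ ∷ Unique-mapMaybe inj u
  where
  go : ∀ {y} → f x ≡ just y → ∀ zs → All (x ≢_) zs → All (y ≢_) (mapMaybe f zs)
  go eq [] [] = []
  go eq (z ∷ zs) (x≢z ∷ r) with f z in eq′
  ... | nothing = go eq zs r
  ... | just y′ = (λ { refl → x≢z (inj eq eq′) }) ∷ go eq zs r

module Position (_≟ᴬ_ : DecidableEquality A) where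

  pos : List A → A → ℕ
  pos []       x = 0
  pos (y ∷ ys) x with x ≟ᴬ y
  ... | yes _ = 0
  ... | no  _ = suc (pos ys x)

  pos-here : ∀ x xs → pos (x ∷ xs) x ≡ 0
  pos-here x xs with x ≟ᴬ x
  ... | yes _ = refl
  ... | no ¬p = contradiction refl ¬p

  pos-there : ∀ {x y} xs → x ≢ y → pos (y ∷ xs) x ≡ suc (pos xs x)
  pos-there {x} {y} xs x≢y with x ≟ᴬ y
  ... | yes p = contradiction p x≢y
  ... | no  _ = refl

  pos<length : ∀ {x xs} → x ∈ xs → pos xs x < length xs
  pos<length {x} {y ∷ xs} i with x ≟ᴬ y
  ... | yes _ = s≤s z≤n
  pos<length (here p)  | no ¬p = contradiction p ¬p
  pos<length (there i) | no _  = s≤s (pos<length i)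

  pos-injective : ∀ {x y xs} → x ∈ xs → y ∈ xs → pos xs x ≡ pos xs y → x ≡ y
  pos-injective {x} {y} {z ∷ xs} i j eq with x ≟ᴬ z | y ≟ᴬ z
  ... | yes refl | yes refl = refl
  pos-injective (here p) j eq | no ¬p | no _ = contradiction p ¬p
  pos-injective (there i) (here p) eq | no _ | no ¬p = contradiction p ¬p
  pos-injective (there i) (there j) eq | no _ | no _ = pos-injective i j (suc-injective eq)

-- The position in the order of decreasing keys.
module Rank (key : A → ℕ) (xs : List A) where

  larger? : (x : A) → Decidable (λ y → key x < key y)
  larger? x y = key x <? key y

  rank : A → ℕ
  rank x = length (filter (larger? x) xs)

  rank-antitone : ∀ {x y} → x ∈ xs → key y < key x → rank x < rank y
  rank-antitone {x} {y} i lt = length-filter-mono-< (larger? x) (larger? y)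
    (λ _ → <-trans lt) i (<-irrefl refl) lt

  rank<length-filter : {P : Pred A 0ℓ} (P? : Decidable P) → ∀ {x} → x ∈ xs → P x →
                       (∀ {y} → y ∈ xs → key x < key y → P y) → rank x < length (filter P? xs)
  rank<length-filter P? {x} i px up = length-filter-mono-< (larger? x) P? up i (<-irrefl refl) px

  rank<length : ∀ {x} → x ∈ xs → rank x < length xs
  rank<length {x} i = filter-notAll (larger? x) xs (Any.map (λ x≡y lt → <-irrefl (cong key x≡y) lt) i)

  rank-injective : (∀ {x y} → x ∈ xs → y ∈ xs → key x ≡ key y → x ≡ y) →
                   ∀ {x y} → x ∈ xs → y ∈ xs → rank x ≡ rank y → x ≡ y
  rank-injective inj {x} {y} i j eq with <-cmp (key x) (key y)
  ... | tri< lt _ _ = contradiction (sym eq) (<⇒≢ (rank-antitone j lt))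
  ... | tri≈ _ e _  = inj i j e
  ... | tri> _ _ gt = contradiction eq (<⇒≢ (rank-antitone i gt))

-- Edges

module EdgeProperties {n : ℕ} (G : Graph n) where
  open Graph G

  E : Set
  E = Edge G

  edge-≡ : {e e′ : E} → Edge.lo e ≡ Edge.lo e′ → Edge.hi e ≡ Edge.hi e′ → e ≡ e′
  edge-≡ refl refl = refl

  infix 4 _≟ᴱ_
  _≟ᴱ_ : DecidableEquality E
  e ≟ᴱ e′ = map′ (λ (p , q) → edge-≡ p q) (λ p → cong Edge.lo p , cong Edge.hi p)
              ((Edge.lo e ≟ Edge.lo e′) ×-dec (Edge.hi e ≟ Edge.hi e′))

  toEdge-endpoints : (e : E) → toEdge G (Edge.lo e , Edge.hi e) ≡ just e
  toEdge-endpoints (edge u v u<v u~v) with u Fin.<? v | u ~? v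
  ... | yes _   | yes _   = refl
  ... | yes _   | no ¬u~v = ⊥-elim-irr (¬u~v u~v)
  ... | no ¬u<v | _       = ⊥-elim-irr (¬u<v u<v)

  toEdge-just : ∀ {x e} → toEdge G x ≡ just e → x ≡ (Edge.lo e , Edge.hi e)
  toEdge-just {u , v} eq with u Fin.<? v | u ~? v
  toEdge-just {u , v} refl | yes _ | yes _ = refl

  ∈-edges : (e : E) → e ∈ edges G
  ∈-edges e = Anyₚ.mapMaybe⁺ (toEdge G) _ (Anyₚ.map⁺ (Any.map
    (λ { refl → subst (MAny.Any (e ≡_)) (sym (toEdge-endpoints e)) (just refl) })
    (∈-cartesianProduct⁺ (∈-allFin (Edge.lo e)) (∈-allFin (Edge.hi e)))))

  edges-unique : Unique (edges G)
  edges-unique = Unique-mapMaybe (λ p q → trans (toEdge-just p) (sym (toEdge-just q)))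
    (Unique.cartesianProduct⁺ (Unique.allFin⁺ n) (Unique.allFin⁺ n))

  incident₂⇒≡ : ∀ {a b e e′} → a ≢ b → Incident G a e → Incident G b e →
                Incident G a e′ → Incident G b e′ → e ≡ e′
  incident₂⇒≡ a≢b (inj₁ refl) (inj₁ q) _ _ = contradiction (sym q) a≢b
  incident₂⇒≡ a≢b (inj₂ refl) (inj₂ q) _ _ = contradiction (sym q) a≢b
  incident₂⇒≡ a≢b _ _ (inj₁ refl) (inj₁ q) = contradiction (sym q) a≢b
  incident₂⇒≡ a≢b _ _ (inj₂ refl) (inj₂ q) = contradiction (sym q) a≢b
  incident₂⇒≡ a≢b (inj₁ p) (inj₂ q) (inj₁ r) (inj₂ s) = edge-≡ (trans (sym p) r) (trans (sym q) s)
  incident₂⇒≡ a≢b (inj₂ p) (inj₁ q) (inj₂ r) (inj₁ s) = edge-≡ (trans (sym q) s) (trans (sym p) r)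
  incident₂⇒≡ {e = edge lo hi lt _} {e′ = edge lo′ hi′ lt′ _} a≢b (inj₁ refl) (inj₂ refl) (inj₂ refl) (inj₁ refl) =
    ⊥-elim-irr (<-asym lt lt′)
  incident₂⇒≡ {e = edge lo hi lt _} {e′ = edge lo′ hi′ lt′ _} a≢b (inj₂ refl) (inj₁ refl) (inj₁ refl) (inj₂ refl) =
    ⊥-elim-irr (<-asym lt lt′)

  other : Fin n → E → Fin n
  other v e with v ≟ Edge.lo e
  ... | yes _ = Edge.hi e
  ... | no  _ = Edge.lo e

  endpoints~ : (e : E) → Edge.lo e ~ Edge.hi e
  endpoints~ (edge lo hi _ lo~hi) = recompute (lo ~? hi) lo~hi

  incident-other : ∀ v e → Incident G (other v e) e
  incident-other v e with v ≟ Edge.lo e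
  ... | yes _ = inj₂ refl
  ... | no  _ = inj₁ refl

  ~-other : ∀ {v e} → Incident G v e → v ~ other v e
  ~-other {v} {e} i with v ≟ Edge.lo e
  ... | yes refl = endpoints~ e
  ~-other (inj₁ p)    | no ¬p = contradiction p ¬p
  ~-other {e = e} (inj₂ refl) | no _ = ~-sym (endpoints~ e)

  ~⇒≢ : ∀ {u v} → u ~ v → u ≢ v
  ~⇒≢ u~v u≡v = ~-irrefl u≡v u~v

  incident-≢ : ∀ {u v e} → u ≢ v → Incident G u e → Incident G v e → u ≡ other v e
  incident-≢ {u} {v} {e} u≢v i j with v ≟ Edge.lo e
  incident-≢ u≢v (inj₁ p) _ | yes q = contradiction (trans p (sym q)) u≢v
  incident-≢ u≢v (inj₂ p) _ | yes q = p
  incident-≢ u≢v (inj₁ p) _ | no ¬q = p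
  incident-≢ u≢v (inj₂ p) (inj₁ q) | no ¬q = contradiction q ¬q
  incident-≢ u≢v (inj₂ p) (inj₂ q) | no ¬q = contradiction (trans p (sym q)) u≢v

  ~⇒incident₂ : ∀ {u v} → u ~ v → ∃ λ e → Incident G u e × Incident G v e
  ~⇒incident₂ {u} {v} u~v with Finₚ.<-cmp u v
  ... | tri< lt _ _ = edge u v lt u~v , inj₁ refl , inj₂ refl
  ... | tri≈ _ p _  = contradiction p (~⇒≢ u~v)
  ... | tri> _ _ gt = edge v u gt (~-sym u~v) , inj₂ refl , inj₁ refl

  incident₂⇒~ : ∀ {u v e} → u ≢ v → Incident G u e → Incident G v e → v ~ u
  incident₂⇒~ {e = e} u≢v i j = subst (_ ~_) (sym (incident-≢ {e = e} u≢v i j)) (~-other j)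

  antimagicFromLabels : (lab : E → ℕ) → (∀ e → 1 ≤ lab e) → (∀ e → lab e ≤ ∣E∣ G) →
    Injective _≡_ _≡_ lab → Injective _≡_ _≡_ (λ v → ∑ lab (filter (incident? G v) (edges G))) → Antimagic G
  antimagicFromLabels lab 1≤lab lab≤m lab-inj sums-inj = f , λ {u} {v} eq → sums-inj
      (trans (sym (vertexSum≡ u)) (trans eq (vertexSum≡ v)))
    where
    suc-pred-lab : ∀ e → suc (lab e ∸ 1) ≡ lab e
    suc-pred-lab e = m+[n∸m]≡n (1≤lab e)
    lt : ∀ e → lab e ∸ 1 < ∣E∣ G
    lt e = ≤-trans (≤-reflexive (suc-pred-lab e)) (lab≤m e)
    to : E → Fin (∣E∣ G)
    to e = fromℕ< (lt e)
    suc-to : ∀ e → suc (toℕ (to e)) ≡ lab e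
    suc-to e = trans (cong suc (Finₚ.toℕ-fromℕ< (lt e))) (suc-pred-lab e)
    to-inj : Injective _≡_ _≡_ to
    to-inj {e} {e′} eq = lab-inj (trans (sym (suc-to e)) (trans (cong (suc ∘ toℕ) eq) (suc-to e′)))
    all-labels : map to (edges G) ↭ allFin (∣E∣ G)
    all-labels = ⊆∧length≥⇒↭ (Unique.map⁺ to-inj edges-unique) (λ _ → ∈-allFin _)
      (≤-reflexive (trans (length-tabulate (λ i → i)) (sym (length-map to (edges G)))))
    f : Labeling G
    f = mk⤖ (to-inj , λ i → let e , _ , eq = ∈-map⁻ to (∈-resp-↭ (↭-sym all-labels) (∈-allFin i))
                             in e , λ { refl → sym eq })
    vertexSum≡ : ∀ v → vertexSum G f v ≡ ∑ lab (filter (incident? G v) (edges G))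
    vertexSum≡ v = ∑-cong (filter (incident? G v) (edges G)) (λ {e} _ → suc-to e)

module _ {n : ℕ} (G : Graph n) where
  open Graph G

  Δ-attained : 1 ≤ Δ G → ∃ λ v → degree G v ≡ Δ G
  Δ-attained 1≤Δ with argmax-sel (λ d → d) 0 (map (degree G) (allFin n))
  ... | inj₁ Δ≡0 = contradiction (sym Δ≡0) (<⇒≢ 1≤Δ)
  ... | inj₂ i with v , _ , eq ← ∈-map⁻ (degree G) i = v , sym eq

  oneNonNeighbour : ∀ {v} → 2 + degree G v ≡ n → ∃ λ w → v ≢ w × ¬ v ~ w × (∀ a → a ≡ v ⊎ a ≡ w ⊎ v ~ a)
  oneNonNeighbour {v} deg = found _ C↭ (suc-injective (trans (sym (↭-length C↭)) ∣C∣))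
    where
    C : List (Fin n)
    C = filter (∁? (v ~?_)) (allFin n)
    v∈C : v ∈ C
    v∈C = ∈-filter⁺ (∁? (v ~?_)) (∈-allFin v) (~-irrefl refl)
    ∣C∣ : length C ≡ 2
    ∣C∣ = +-cancelˡ-≡ (degree G v) _ _ (trans (sym (length-++ (filter (v ~?_) (allFin n))))
      (trans (sym (↭-length (filter-∁-↭ (v ~?_) (allFin n))))
      (trans (length-tabulate (λ i → i)) (trans (sym deg) (+-comm 2 (degree G v))))))
    v∷-C : ∃ λ zs → C ↭ v ∷ zs
    v∷-C = ⊆⇒↭++ {xs = [ v ]} ([] ∷ []) (λ { (here refl) → v∈C })
    C↭ : C ↭ v ∷ proj₁ v∷-C
    C↭ = proj₂ v∷-C
    found : ∀ zs → C ↭ v ∷ zs → length zs ≡ 1 → ∃ λ w → v ≢ w × ¬ v ~ w × (∀ a → a ≡ v ⊎ a ≡ w ⊎ v ~ a)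
    found (w ∷ []) C↭ _ = w , v≢w ,
        proj₂ (∈-filter⁻ (∁? (v ~?_)) {xs = allFin n} (∈-resp-↭ (↭-sym C↭) (there (here refl)))) , cover
      where
      v≢w : v ≢ w
      v≢w with (v≢w ∷ []) ∷ _ ← Unique-resp-↭ C↭ (Unique.filter⁺ (∁? (v ~?_)) (Unique.allFin⁺ n)) = v≢w
      cover : ∀ a → a ≡ v ⊎ a ≡ w ⊎ v ~ a
      cover a with v ~? a
      ... | yes p = inj₂ (inj₂ p)
      ... | no ¬p with ∈-resp-↭ C↭ (∈-filter⁺ (∁? (v ~?_)) (∈-allFin a) ¬p)
      ...   | here a≡v         = inj₁ a≡v
      ...   | there (here a≡w) = inj₂ (inj₁ a≡w)

-- Labels decreasing with the partial sums

-- Ties between equal partial sums are broken by the index of the vertex.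
module Decreasing {n : ℕ} (p : Fin n → ℕ) (U : List (Fin n)) where

  key : Fin n → ℕ
  key u = p u * n + toℕ u

  open Rank key U public

  p<⇒key< : ∀ {u u′} → p u < p u′ → key u < key u′
  p<⇒key< {u} {u′} lt = begin-strict
    p u * n + toℕ u   <⟨ +-monoʳ-< (p u * n) (Finₚ.toℕ<n u) ⟩
    p u * n + n       ≡⟨ +-comm (p u * n) n ⟩
    suc (p u) * n     ≤⟨ *-monoˡ-≤ n lt ⟩
    p u′ * n          ≤⟨ m≤m+n (p u′ * n) (toℕ u′) ⟩
    p u′ * n + toℕ u′ ∎
    where open ≤-Reasoning

  key<⇒p≤ : ∀ {u u′} → key u < key u′ → p u ≤ p u′
  key<⇒p≤ lt = ≮⇒≥ (λ gt → <-asym lt (p<⇒key< gt))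

  key-injective : ∀ {u u′} → key u ≡ key u′ → u ≡ u′
  key-injective {u} {u′} eq with <-cmp (p u) (p u′)
  ... | tri< lt _ _ = contradiction eq (<⇒≢ (p<⇒key< lt))
  ... | tri> _ _ gt = contradiction (sym eq) (<⇒≢ (p<⇒key< gt))
  ... | tri≈ _ e _  = Finₚ.toℕ-injective (+-cancelˡ-≡ (p u * n) _ _
                        (trans eq (cong (λ z → z * n + toℕ u′) (sym e))))

  rank-injective′ : ∀ {u u′} → u ∈ U → u′ ∈ U → rank u ≡ rank u′ → u ≡ u′
  rank-injective′ = rank-injective (λ _ _ → key-injective)

  module Labels (g : ℕ → ℕ) (g-antitone : ∀ {i j} → i < j → j < length U → g j < g i) where

    label-injective : ∀ {u u′} → u ∈ U → u′ ∈ U → g (rank u) ≡ g (rank u′) → u ≡ u′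
    label-injective {u} {u′} i j eq with <-cmp (rank u) (rank u′)
    ... | tri< lt _ _ = contradiction (sym eq) (<⇒≢ (g-antitone lt (rank<length j)))
    ... | tri≈ _ e _  = rank-injective′ i j e
    ... | tri> _ _ gt = contradiction eq (<⇒≢ (g-antitone gt (rank<length i)))

    key<⇒sum< : ∀ {u u′} → u ∈ U → u′ ∈ U → key u < key u′ → g (rank u) + p u < g (rank u′) + p u′
    key<⇒sum< i j lt = +-mono-<-≤ (g-antitone (rank-antitone j lt) (rank<length i)) (key<⇒p≤ lt)

    sum-injective : ∀ {u u′} → u ∈ U → u′ ∈ U → g (rank u) + p u ≡ g (rank u′) + p u′ → u ≡ u′
    sum-injective {u} {u′} i j eq with <-cmp (key u) (key u′)
    ... | tri< lt _ _ = contradiction eq (<⇒≢ (key<⇒sum< i j lt))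
    ... | tri≈ _ e _  = key-injective e
    ... | tri> _ _ gt = contradiction (sym eq) (<⇒≢ (key<⇒sum< j i gt))

-- Alternating labels

-- The labels 1, …, 2k + t are split into h 0 > h 1 > … > h (k − 1), which are 2k + t − 1, 2k + t − 3, …, t + 1,
-- and g 0 > g 1 > …, which are 2k + t, 2k + t − 2, …, t followed by t − 1, t − 2, …, 1.
h g : (k t : ℕ) → ℕ → ℕ
h k t i = suc t + 2 * (k ∸ suc i)
g k t i = (k + t ∸ i) + (k ∸ i)

2∣h : ∀ k s i → 2 ∣ h k (suc (2 * s)) i
2∣h k s i = ∣m∣n⇒∣m+n (divides (suc s) (cong (suc ∘ suc) (*-comm 2 s))) (m∣m*n (k ∸ suc i))

h-injective : ∀ k t {i j} → i < k → j < k → h k t i ≡ h k t j → i ≡ j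
h-injective k t i<k j<k eq =
  suc-injective (∸-cancelˡ-≡ i<k j<k (*-cancelˡ-≡ _ _ 2 (+-cancelˡ-≡ (suc t) _ _ eq)))

h≤ : ∀ k t i → 1 ≤ k → h k t i ≤ (k + t) + k
h≤ (suc k) t i _ = ≤-trans (+-monoʳ-≤ (suc t) (*-monoʳ-≤ 2 (m∸n≤m k i)))
  (≤-trans (n≤1+n _) (≤-reflexive (eq k t)))
  where
  eq : ∀ k t → suc (suc t + 2 * k) ≡ suc k + t + suc k
  eq = solve-∀

g-antitone : ∀ k t {i j} → i < j → j < k + t → g k t j < g k t i
g-antitone k t i<j j<k+t = +-mono-<-≤ (∸-monoʳ-< i<j (<⇒≤ j<k+t)) (∸-monoʳ-≤ k (<⇒≤ i<j))

1≤g : ∀ k t {i} → i < k + t → 1 ≤ g k t i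
1≤g k t i<k+t = ≤-trans (m<n⇒0<n∸m i<k+t) (m≤m+n _ _)

g≤ : ∀ k t i → g k t i ≤ (k + t) + k
g≤ k t i = +-mono-≤ (m∸n≤m (k + t) i) (m∸n≤m k i)

g-odd : ∀ k s {i e} → i ≤ k → 2 ∣ e → ¬ 2 ∣ g k (suc (2 * s)) i + e
g-odd k s {i} i≤k 2∣e 2∣sum = 2∤1 (∣m+n∣m⇒∣n (subst (2 ∣_) eq (∣m+n∣n⇒∣m 2∣sum 2∣e)) (m∣m*n (k ∸ i + s)))
  where
  ∣m+n∣n⇒∣m : ∀ {a m n} → a ∣ m + n → a ∣ n → a ∣ m
  ∣m+n∣n⇒∣m {a} {m} {n} p = ∣m+n∣m⇒∣n (subst (a ∣_) (+-comm m n) p)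
  2∤1 : ¬ 2 ∣ 1
  2∤1 p with () ← ∣1⇒≡1 p
  expand : ∀ d s → (d + suc (2 * s)) + d ≡ 2 * (d + s) + 1
  expand = solve-∀
  eq : g k (suc (2 * s)) i ≡ 2 * (k ∸ i + s) + 1
  eq = trans (cong (_+ (k ∸ i)) (+-∸-comm (suc (2 * s)) i≤k)) (expand (k ∸ i) s)

g<t : ∀ k t {i} → k < i → i < k + t → g k t i < t
g<t k t {i} k<i i<k+t = begin-strict
  (k + t ∸ i) + (k ∸ i) ≡⟨ cong ((k + t ∸ i) +_) (m≤n⇒m∸n≡0 (<⇒≤ k<i)) ⟩
  (k + t ∸ i) + 0       ≡⟨ +-identityʳ _ ⟩
  k + t ∸ i             <⟨ ∸-monoʳ-< k<i (<⇒≤ i<k+t) ⟩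
  k + t ∸ k             ≡⟨ m+n∸m≡n k t ⟩
  t                     ∎
  where open ≤-Reasoning

h≢g : ∀ k s {i j} → j < k + suc (2 * s) → h k (suc (2 * s)) i ≢ g k (suc (2 * s)) j
h≢g k s {i} {j} j< eq with j ≤? k
... | yes j≤k = g-odd k s j≤k (2 ∣0) (subst (2 ∣_) (trans eq (sym (+-identityʳ _))) (2∣h k s i))
... | no  j≰k = <⇒≢ (<-trans (g<t k _ (≰⇒> j≰k) j<) (m≤m+n _ _)) (sym eq)

∑h+k+t≤∑g : ∀ k t → 1 ≤ t → ∑ (h k t) (upTo k) + (k + t) ≤ ∑ (g k t) (upTo (k + t))
∑h+k+t≤∑g k t 1≤t = begin
  ∑ (h k t) (upTo k) + (k + t)     ≡⟨ +-assoc (∑ (h k t) (upTo k)) k t ⟨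
  ∑ (h k t) (upTo k) + k + t       ≡⟨ cong (_+ t) (shifted k ≤-refl) ⟨
  ∑ (g k t) (upTo k) + t           ≡⟨ cong (∑ (g k t) (upTo k) +_) g-k ⟨
  ∑ (g k t) (upTo k) + g k t k     ≡⟨ ∑-upTo-suc (g k t) k ⟨
  ∑ (g k t) (upTo (suc k))         ≤⟨ ∑-upTo-mono (g k t) (≤-trans (≤-reflexive (+-comm 1 k)) (+-monoʳ-≤ k 1≤t)) ⟩
  ∑ (g k t) (upTo (k + t))         ∎
  where
  open ≤-Reasoning
  g-k : g k t k ≡ t
  g-k = trans (cong₂ _+_ (m+n∸m≡n k t) (n∸n≡0 k)) (+-identityʳ t)
  expand : ∀ d t → (suc d + t) + suc d ≡ suc (suc t + 2 * d)
  expand = solve-∀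
  g≡suc-h : ∀ i → i < k → g k t i ≡ suc (h k t i)
  g≡suc-h i i<k = trans (cong (_+ (k ∸ i)) (+-∸-comm t (<⇒≤ i<k)))
    (trans (cong (λ d → (d + t) + d) (+-∸-assoc 1 i<k)) (expand (k ∸ suc i) t))
  shifted : ∀ j → j ≤ k → ∑ (g k t) (upTo j) ≡ ∑ (h k t) (upTo j) + j
  shifted zero _ = refl
  shifted (suc j) j<k = begin-equality
    ∑ (g k t) (upTo (suc j))                     ≡⟨ ∑-upTo-suc (g k t) j ⟩
    ∑ (g k t) (upTo j) + g k t j                 ≡⟨ cong₂ _+_ (shifted j (<⇒≤ j<k)) (g≡suc-h j j<k) ⟩
    (∑ (h k t) (upTo j) + j) + suc (h k t j)     ≡⟨ regroup (∑ (h k t) (upTo j)) j (h k t j) ⟩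
    (∑ (h k t) (upTo j) + h k t j) + suc j       ≡⟨ cong (_+ suc j) (∑-upTo-suc (h k t) j) ⟨
    ∑ (h k t) (upTo (suc j)) + suc j             ∎
    where
    regroup : ∀ a b c → (a + b) + suc c ≡ (a + c) + suc b
    regroup = solve-∀

even-or-odd : ∀ d → ∃ λ s → d ≡ 2 * s ⊎ d ≡ suc (2 * s)
even-or-odd zero = 0 , inj₁ refl
even-or-odd (suc d) with even-or-odd d
... | s , inj₁ eq = s , inj₂ (cong suc eq)
... | s , inj₂ eq = suc s , inj₁ (trans (cong suc eq) (sym (*-suc 2 s)))

module OneNonNeighbour {n : ℕ} (G : Graph n) (v w : Fin n)
  (v≢w : v ≢ w) (v≁w : ¬ Graph._~_ G v w)
  (cover : ∀ a → a ≡ v ⊎ a ≡ w ⊎ Graph._~_ G v a)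
  where
  open Graph G
  open EdgeProperties G

  module Core
    (U : List (Fin n)) (U↭ : filter (v ~?_) (allFin n) ↭ U)
    (H : List (Edge G)) (H↭ : filter (∁? (incident? G v)) (edges G) ↭ H)
    where
    S : List E
    S = filter (incident? G v) (edges G)

    ∈U⇒~ : ∀ {u} → u ∈ U → v ~ u
    ∈U⇒~ i = proj₂ (∈-filter⁻ (v ~?_) {xs = allFin n} (∈-resp-↭ (↭-sym U↭) i))

    ~⇒∈U : ∀ {u} → v ~ u → u ∈ U
    ~⇒∈U p = ∈-resp-↭ U↭ (∈-filter⁺ (v ~?_) (∈-allFin _) p)

    U-unique : Unique U
    U-unique = Unique-resp-↭ U↭ (Unique.filter⁺ (v ~?_) (Unique.allFin⁺ n))

    w∉U : w ∉ U
    w∉U i = v≁w (∈U⇒~ i)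

    ∈H⇒¬incident : ∀ {e} → e ∈ H → ¬ Incident G v e
    ∈H⇒¬incident i = proj₂ (∈-filter⁻ (∁? (incident? G v)) {xs = edges G} (∈-resp-↭ (↭-sym H↭) i))

    ¬incident⇒∈H : ∀ {e} → ¬ Incident G v e → e ∈ H
    ¬incident⇒∈H p = ∈-resp-↭ H↭ (∈-filter⁺ (∁? (incident? G v)) (∈-edges _) p)

    H-unique : Unique H
    H-unique = Unique-resp-↭ H↭ (Unique.filter⁺ (∁? (incident? G v)) edges-unique)

    edges↭S++H : edges G ↭ S ++ H
    edges↭S++H = ↭-trans (filter-∁-↭ (incident? G v) (edges G)) (++⁺ˡ S H↭)

    ∈S⇒incident : ∀ {e} → e ∈ S → Incident G v e
    ∈S⇒incident = proj₂ ∘ ∈-filter⁻ (incident? G v) {xs = edges G}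

    S-unique : Unique S
    S-unique = Unique.filter⁺ (incident? G v) edges-unique

    other-injective : ∀ {e e′} → Incident G v e → Incident G v e′ → other v e ≡ other v e′ → e ≡ e′
    other-injective {e} {e′} i j eq = incident₂⇒≡ (~⇒≢ (~-other i)) i (incident-other v e) j
      (subst (λ z → Incident G z e′) (sym eq) (incident-other v e′))

    other-S↭U : map (other v) S ↭ U
    other-S↭U = ⊆∧⊇⇒↭ (Unique-map-local S-unique (λ i j → other-injective (∈S⇒incident i) (∈S⇒incident j)))
      U-unique sub sup
      where
      sub : map (other v) S ⊆ U
      sub i with ∈-map⁻ (other v) i
      ... | e , e∈ , refl = ~⇒∈U (~-other (∈S⇒incident e∈))
      sup : U ⊆ map (other v) S
      sup i with e , p , q ← ~⇒incident₂ (∈U⇒~ i) =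
        subst (_∈ map (other v) S) (sym (incident-≢ (~⇒≢ (∈U⇒~ i) ∘ sym) q p))
          (∈-map⁺ (other v) (∈-filter⁺ (incident? G v) (∈-edges e) p))

    ∣E∣≡ : ∣E∣ G ≡ length U + length H
    ∣E∣≡ = trans (↭-length edges↭S++H) (trans (length-++ S)
      (cong (_+ length H) (trans (sym (length-map (other v) S)) (↭-length other-S↭U))))

    partialSum : (E → ℕ) → Fin n → ℕ
    partialSum L u = ∑ L (filter (incident? G u) H)

    -- Every edge has at most two endpoints, none of which is v when the edge is in H.
    handshake : ∑ (λ u → length (filter (incident? G u) H)) U + length (filter (incident? G w) H) ≤ length H * 2
    handshake = begin
      ∑ deg U + deg w       ≡⟨ +-comm (∑ deg U) (deg w) ⟩
      ∑ deg (w ∷ U)         ≡⟨ double-counting (incident? G) (w ∷ U) H ⟩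
      ∑ (λ e → length (filter (λ u → incident? G u e) (w ∷ U))) H ≤⟨ ∑≤length* H (λ {e} _ → ends e) ⟩
      length H * 2          ∎
      where
      open ≤-Reasoning
      deg : Fin n → ℕ
      deg u = length (filter (incident? G u) H)
      ends : ∀ e → length (filter (λ u → incident? G u e) (w ∷ U)) ≤ 2
      ends e = ⊆⇒length≤ (Unique.filter⁺ (λ u → incident? G u e) (All.tabulate (λ i → λ { refl → w∉U i }) ∷ U-unique))
        sub
        where
        sub : filter (λ u → incident? G u e) (w ∷ U) ⊆ Edge.lo e ∷ Edge.hi e ∷ []
        sub i with proj₂ (∈-filter⁻ (λ u → incident? G u e) {xs = w ∷ U} i)
        ... | inj₁ refl = here refl
        ... | inj₂ refl = there (here refl)

    antimagic : (LH : E → ℕ) (LU : Fin n → ℕ) →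
      (∀ {e} → e ∈ H → 1 ≤ LH e × LH e ≤ ∣E∣ G) →
      (∀ {u} → u ∈ U → 1 ≤ LU u × LU u ≤ ∣E∣ G) →
      (∀ {e e′} → e ∈ H → e′ ∈ H → LH e ≡ LH e′ → e ≡ e′) →
      (∀ {u u′} → u ∈ U → u′ ∈ U → LU u ≡ LU u′ → u ≡ u′) →
      (∀ {e u} → e ∈ H → u ∈ U → LH e ≢ LU u) →
      (∀ {u u′} → u ∈ U → u′ ∈ U → LU u + partialSum LH u ≡ LU u′ + partialSum LH u′ → u ≡ u′) →
      (∀ {u} → u ∈ U → partialSum LH w ≢ LU u + partialSum LH u) →
      (∀ {u} → u ∈ U → LU u + partialSum LH u < ∑ LU U) →
      partialSum LH w < ∑ LU U → Antimagic G
    antimagic LH LU boundH boundU injH injU disj distinct w≢ <v w<v =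
      antimagicFromLabels lab (proj₁ ∘ bound) (proj₂ ∘ bound) lab-inj sums-inj
      where
      lab : E → ℕ
      lab e with incident? G v e
      ... | yes _ = LU (other v e)
      ... | no  _ = LH e

      bound : ∀ e → 1 ≤ lab e × lab e ≤ ∣E∣ G
      bound e with incident? G v e
      ... | yes p = boundU (~⇒∈U (~-other p))
      ... | no ¬p = boundH (¬incident⇒∈H ¬p)

      lab-inj : Injective _≡_ _≡_ lab
      lab-inj {e} {e′} eq with incident? G v e | incident? G v e′
      ... | yes p | yes q = other-injective p q (injU (~⇒∈U (~-other p)) (~⇒∈U (~-other q)) eq)
      ... | yes p | no ¬q = contradiction (sym eq) (disj (¬incident⇒∈H ¬q) (~⇒∈U (~-other p)))
      ... | no ¬p | yes q = contradiction eq (disj (¬incident⇒∈H ¬p) (~⇒∈U (~-other q)))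
      ... | no ¬p | no ¬q = injH (¬incident⇒∈H ¬p) (¬incident⇒∈H ¬q) eq

      lab-S : ∀ {e} → Incident G v e → lab e ≡ LU (other v e)
      lab-S {e} p with incident? G v e
      ... | yes _ = refl
      ... | no ¬p = contradiction p ¬p

      lab-H : ∀ {e} → e ∈ H → lab e ≡ LH e
      lab-H {e} i with incident? G v e
      ... | yes p = contradiction p (∈H⇒¬incident i)
      ... | no _  = refl

      at : Fin n → List E
      at u = filter (incident? G u) S

      total : Fin n → ℕ
      total u = ∑ lab (filter (incident? G u) (edges G))

      total≡ : ∀ u → total u ≡ ∑ lab (at u) + partialSum LH u
      total≡ u = begin
        ∑ lab (filter (incident? G u) (edges G))
          ≡⟨ ∑-↭ lab (filter-↭ (incident? G u) edges↭S++H) ⟩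
        ∑ lab (filter (incident? G u) (S ++ H))
          ≡⟨ cong (∑ lab) (filter-++ (incident? G u) S H) ⟩
        ∑ lab (at u ++ filter (incident? G u) H)
          ≡⟨ ∑-++ lab (at u) (filter (incident? G u) H) ⟩
        ∑ lab (at u) + ∑ lab (filter (incident? G u) H)
          ≡⟨ cong (∑ lab (at u) +_) (∑-cong (filter (incident? G u) H)
               (λ i → lab-H (proj₁ (∈-filter⁻ (incident? G u) i)))) ⟩
        ∑ lab (at u) + partialSum LH u ∎
        where open ≡-Reasoning

      total-w : total w ≡ partialSum LH w
      total-w = trans (total≡ w) (cong (λ es → ∑ lab es + partialSum LH w)
        (filter-none (incident? G w) (All.tabulate (λ {e} i j → v≁w (incident₂⇒~ {e = e} (v≢w ∘ sym) j (∈S⇒incident i))))))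

      total-U : ∀ {u} → u ∈ U → total u ≡ LU u + partialSum LH u
      total-U {u} i with e , p , q ← ~⇒incident₂ (∈U⇒~ i) = trans (total≡ u) (cong (_+ partialSum LH u) (begin
        ∑ lab (at u)      ≡⟨ ∑-↭ lab at↭ ⟩
        lab e + 0         ≡⟨ +-identityʳ (lab e) ⟩
        lab e             ≡⟨ lab-S p ⟩
        LU (other v e)    ≡⟨ cong LU (incident-≢ u≢v q p) ⟨
        LU u              ∎))
        where
        open ≡-Reasoning
        u≢v : u ≢ v
        u≢v = ~⇒≢ (∈U⇒~ i) ∘ sym
        at↭ : at u ↭ [ e ]
        at↭ = ⊆∧⊇⇒↭ (Unique.filter⁺ (incident? G u) S-unique) ([] ∷ [])
          (λ j → let j∈S , j∋u = ∈-filter⁻ (incident? G u) j in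
                 here (incident₂⇒≡ u≢v j∋u (∈S⇒incident j∈S) q p))
          (λ { (here refl) → ∈-filter⁺ (incident? G u) (∈-filter⁺ (incident? G v) (∈-edges e) p) q })

      total-v : total v ≡ ∑ LU U
      total-v = begin
        ∑ lab S                          ≡⟨ ∑-cong S (lab-S ∘ ∈S⇒incident) ⟩
        ∑ (LU ∘ other v) S               ≡⟨ cong sum (map-∘ S) ⟩
        ∑ LU (map (other v) S)           ≡⟨ ∑-↭ LU other-S↭U ⟩
        ∑ LU U                           ∎
        where open ≡-Reasoning

      sums-inj : Injective _≡_ _≡_ total
      sums-inj {a} {b} eq with cover a | cover b
      ... | inj₁ refl | inj₁ refl = refl
      ... | inj₂ (inj₁ refl) | inj₂ (inj₁ refl) = refl
      ... | inj₁ refl | inj₂ (inj₁ refl) =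
        contradiction (trans (sym total-w) (trans (sym eq) total-v)) (<⇒≢ w<v)
      ... | inj₂ (inj₁ refl) | inj₁ refl =
        contradiction (trans (sym total-w) (trans eq total-v)) (<⇒≢ w<v)
      ... | inj₁ refl | inj₂ (inj₂ p) =
        contradiction (trans (sym (total-U (~⇒∈U p))) (trans (sym eq) total-v)) (<⇒≢ (<v (~⇒∈U p)))
      ... | inj₂ (inj₂ p) | inj₁ refl =
        contradiction (trans (sym (total-U (~⇒∈U p))) (trans eq total-v)) (<⇒≢ (<v (~⇒∈U p)))
      ... | inj₂ (inj₁ refl) | inj₂ (inj₂ p) =
        contradiction (trans (sym total-w) (trans eq (total-U (~⇒∈U p)))) (w≢ (~⇒∈U p))
      ... | inj₂ (inj₂ p) | inj₂ (inj₁ refl) =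
        contradiction (trans (sym total-w) (trans (sym eq) (total-U (~⇒∈U p)))) (w≢ (~⇒∈U p))
      ... | inj₂ (inj₂ p) | inj₂ (inj₂ q) =
        distinct (~⇒∈U p) (~⇒∈U q) (trans (sym (total-U (~⇒∈U p))) (trans eq (total-U (~⇒∈U q))))

  module LowLabels where
    private
      U = filter (v ~?_) (allFin n)
      H = filter (∁? (incident? G v)) (edges G)
      k = length H
      r = length U
    open Core U ↭-refl H ↭-refl
    open Position _≟ᴱ_

    LH : E → ℕ
    LH e = suc (pos H e)

    LH≤k : ∀ {e} → e ∈ H → LH e ≤ k
    LH≤k = pos<length

    open Decreasing (partialSum LH) U

    LU : Fin n → ℕ
    LU u = k + r ∸ rank u

    k<LU : ∀ {u} → u ∈ U → k < LU u
    k<LU {u} i = begin-strict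
      k                 <⟨ m<m+n k (m<n⇒0<n∸m (rank<length i)) ⟩
      k + (r ∸ rank u)  ≡⟨ +-∸-assoc k (<⇒≤ (rank<length i)) ⟨
      k + r ∸ rank u    ∎
      where open ≤-Reasoning

    open Labels (λ i → k + r ∸ i) (λ i<j j<r → ∸-monoʳ-< i<j (m≤n⇒m≤o+n k (<⇒≤ j<r)))

    k*k<z*suc-k : ∀ z → k ≤ z → 1 ≤ z → k * k < z * suc k
    k*k<z*suc-k z k≤z 1≤z = ≤-trans (s≤s (*-monoˡ-≤ k k≤z))
      (≤-trans (+-monoˡ-≤ (z * k) 1≤z) (≤-reflexive (sym (*-suc z k))))

    lowAntimagic : k < r → 2 ≤ r → length (filter (incident? G w) H) ≤ 1 → Antimagic G
    lowAntimagic k<r 2≤r deg-w≤1 = antimagic LH LU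
      (λ i → s≤s z≤n , ≤-trans (LH≤k i) (≤-trans (m≤n+m k r) (≤-reflexive (sym ∣E∣≡))))
      (λ {u} i → ≤-trans (s≤s z≤n) (k<LU i) ,
             ≤-trans (m∸n≤m (k + r) (rank u)) (≤-reflexive (trans (+-comm k r) (sym ∣E∣≡))))
      (λ i j eq → pos-injective i j (suc-injective eq))
      label-injective
      (λ i j → <⇒≢ (≤-<-trans (LH≤k i) (k<LU j)))
      sum-injective
      (λ {u} i → <⇒≢ (≤-trans (≤-<-trans p-w≤k (k<LU i)) (m≤m+n (LU u) _)))
      <v
      w<v
      where
      p-w≤k : partialSum LH w ≤ k
      p-w≤k = ≤-trans (∑≤length* (filter (incident? G w) H) (LH≤k ∘ proj₁ ∘ ∈-filter⁻ (incident? G w)))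
        (≤-trans (*-monoˡ-≤ k deg-w≤1) (≤-reflexive (*-identityˡ k)))
      <v : ∀ {u} → u ∈ U → LU u + partialSum LH u < ∑ LU U
      <v {u} i with zs , U↭u∷zs ← ⊆⇒↭++ {xs = [ u ]} ([] ∷ []) (λ { (here refl) → i }) = begin-strict
        LU u + partialSum LH u ≤⟨ +-monoʳ-≤ (LU u) (∑-filter-≤ (incident? G u) LH H) ⟩
        LU u + ∑ LH H          ≤⟨ +-monoʳ-≤ (LU u) (∑≤length* H LH≤k) ⟩
        LU u + k * k           <⟨ +-monoʳ-< (LU u) (k*k<z*suc-k (length zs)
                                    (s≤s⁻¹ (≤-trans k<r r≤)) (s≤s⁻¹ (≤-trans 2≤r r≤))) ⟩
        LU u + length zs * suc k ≤⟨ +-monoʳ-≤ (LU u) (length*≤∑ zs (λ j → k<LU (∈-resp-↭ (↭-sym U↭u∷zs) (there j)))) ⟩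
        ∑ LU (u ∷ zs)          ≡⟨ ∑-↭ LU U↭u∷zs ⟨
        ∑ LU U                 ∎
        where
        open ≤-Reasoning
        r≤ : r ≤ suc (length zs)
        r≤ = ≤-reflexive (↭-length U↭u∷zs)
      w<v : partialSum LH w < ∑ LU U
      w<v = begin-strict
        partialSum LH w ≤⟨ p-w≤k ⟩
        k               <⟨ n<1+n k ⟩
        suc k           ≡⟨ *-identityˡ (suc k) ⟨
        1 * suc k       ≤⟨ *-monoˡ-≤ (suc k) (≤-trans (n≤1+n 1) 2≤r) ⟩
        r * suc k       ≤⟨ length*≤∑ U k<LU ⟩
        ∑ LU U          ∎
        where open ≤-Reasoning

  module TwoEdges
    (U : List (Fin n)) (U↭ : filter (v ~?_) (allFin n) ↭ U)
    (e₁ e₂ : Edge G) (rest : List (Edge G))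
    (H↭ : filter (∁? (incident? G v)) (edges G) ↭ e₁ ∷ e₂ ∷ rest)
    (w∈e₁ : Incident G w e₁) (w∈e₂ : Incident G w e₂)
    where
    open Position _≟ᴱ_ public

    H : List E
    H = e₁ ∷ e₂ ∷ rest

    k : ℕ
    k = length H

    open Core U U↭ H H↭ public

    e₂≢e₁ : e₂ ≢ e₁
    e₂≢e₁ with (e₁≢e₂ ∷ _) ∷ _ ← H-unique = e₁≢e₂ ∘ sym

    not-both : ∀ {u} → u ≢ w → Incident G u e₁ → ¬ Incident G u e₂
    not-both u≢w i j = e₂≢e₁ (incident₂⇒≡ u≢w j w∈e₂ i w∈e₁)

    ∈U⇒≢w : ∀ {u} → u ∈ U → u ≢ w
    ∈U⇒≢w i refl = w∉U i

    x : Fin n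
    x = other w e₁

    x∈e₁ : Incident G x e₁
    x∈e₁ = incident-other w e₁

    x∈U : x ∈ U
    x∈U with cover x
    ... | inj₁ x≡v = contradiction (subst (λ a → Incident G a e₁) x≡v x∈e₁) (∈H⇒¬incident (here refl))
    ... | inj₂ (inj₁ x≡w) = contradiction (sym x≡w) (~⇒≢ (~-other w∈e₁))
    ... | inj₂ (inj₂ v~x) = ~⇒∈U v~x

    x∉e₂ : ¬ Incident G x e₂
    x∉e₂ = not-both (∈U⇒≢w x∈U) x∈e₁

    pos-rest : ∀ {e} → e ∈ rest → pos H e ≡ 2 + pos rest e
    pos-rest i with (_ ∷ e₁∉) ∷ (e₂∉ ∷ _) ← H-unique =
      trans (pos-there (e₂ ∷ rest) (All.lookup e₁∉ i ∘ sym)) (cong suc (pos-there rest (All.lookup e₂∉ i ∘ sym)))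

    module _ (f : ℕ → ℕ) where

      LH : E → ℕ
      LH e = f (pos H e)

      LH-e₁ : LH e₁ ≡ f 0
      LH-e₁ = cong f (pos-here e₁ (e₂ ∷ rest))

      LH-e₂ : LH e₂ ≡ f 1
      LH-e₂ = cong f (trans (pos-there (e₂ ∷ rest) e₂≢e₁) (cong suc (pos-here e₂ rest)))

      base : Fin n → ℕ
      base u = ∑ (λ e → f (2 + pos rest e)) (filter (incident? G u) rest)

      base≡ : ∀ u → ∑ LH (filter (incident? G u) rest) ≡ base u
      base≡ u = ∑-cong (filter (incident? G u) rest) (cong f ∘ pos-rest ∘ proj₁ ∘ ∈-filter⁻ (incident? G u))

      partialSum-both : ∀ {u} → Incident G u e₁ → Incident G u e₂ → partialSum LH u ≡ f 0 + (f 1 + base u)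
      partialSum-both {u} i j = trans (cong (∑ LH) (trans (filter-accept (incident? G u) i)
          (cong (e₁ ∷_) (filter-accept (incident? G u) j))))
        (cong₂ _+_ LH-e₁ (cong₂ _+_ LH-e₂ (base≡ u)))

      partialSum-e₁ : ∀ {u} → Incident G u e₁ → ¬ Incident G u e₂ → partialSum LH u ≡ f 0 + base u
      partialSum-e₁ {u} i j = trans (cong (∑ LH) (trans (filter-accept (incident? G u) i)
          (cong (e₁ ∷_) (filter-reject (incident? G u) j))))
        (cong₂ _+_ LH-e₁ (base≡ u))

      partialSum-e₂ : ∀ {u} → ¬ Incident G u e₁ → Incident G u e₂ → partialSum LH u ≡ f 1 + base u
      partialSum-e₂ {u} i j = trans (cong (∑ LH) (trans (filter-reject (incident? G u) i)
          (filter-accept (incident? G u) j)))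
        (cong₂ _+_ LH-e₂ (base≡ u))

      partialSum-neither : ∀ {u} → ¬ Incident G u e₁ → ¬ Incident G u e₂ → partialSum LH u ≡ base u
      partialSum-neither {u} i j = trans (cong (∑ LH) (trans (filter-reject (incident? G u) i)
          (filter-reject (incident? G u) j)))
        (base≡ u)

      ∑LH : ∑ LH H ≡ ∑ f (upTo k)
      ∑LH = ∑-reindex H-unique pos-injective pos<length f

      partialSum-omit : f 1 ≤ f 0 → ∀ {u} → u ≢ w → partialSum LH u + f 1 ≤ ∑ LH H
      partialSum-omit f1≤f0 {u} u≢w with incident? G u e₁
      ... | yes i = subst (λ z → partialSum LH u + z ≤ ∑ LH H) LH-e₂
                      (∑-filter-omit (incident? G u) LH (there (here refl)) (not-both u≢w i))
      ... | no ¬i = ≤-trans (+-monoʳ-≤ (partialSum LH u) (≤-trans f1≤f0 (≤-reflexive (sym LH-e₁))))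
                      (∑-filter-omit (incident? G u) LH (here refl) ¬i)

  module Alternating
    (U : List (Fin n)) (U↭ : filter (v ~?_) (allFin n) ↭ U)
    (e₁ e₂ : Edge G) (rest : List (Edge G))
    (H↭ : filter (∁? (incident? G v)) (edges G) ↭ e₁ ∷ e₂ ∷ rest)
    (w∈e₁ : Incident G w e₁) (w∈e₂ : Incident G w e₂)
    (V : List (Fin n)) (V-unique : Unique V) (V⊆U : V ⊆ U)
    (s : ℕ) (∣V∣ : length V ≡ 2 + length rest + suc (2 * s))
    where
    open TwoEdges U U↭ e₁ e₂ rest H↭ w∈e₁ w∈e₂ public

    t : ℕ
    t = suc (2 * s)

    L : E → ℕ
    L = LH (h k t)

    p : Fin n → ℕ
    p = partialSum L

    open Decreasing p V public

    LV : Fin n → ℕ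
    LV u = g k t (rank u)

    open Labels (g k t) (λ i<j j< → g-antitone k t i<j (subst (_ <_) ∣V∣ j<)) public

    rank< : ∀ {u} → u ∈ V → rank u < k + t
    rank< {u} i = subst (rank u <_) ∣V∣ (rank<length i)

    L-injective : ∀ {e e′} → e ∈ H → e′ ∈ H → L e ≡ L e′ → e ≡ e′
    L-injective i j eq = pos-injective i j (h-injective k t (pos<length i) (pos<length j) eq)

    L≤ : ∀ e → L e ≤ (k + t) + k
    L≤ e = h≤ k t (pos H e) (s≤s z≤n)

    h1≤h0 : h k t 1 ≤ h k t 0
    h1≤h0 = +-monoʳ-≤ (suc t) (*-monoʳ-≤ 2 (n≤1+n _))

    L≤h0 : ∀ e → L e ≤ h k t 0
    L≤h0 e = +-monoʳ-≤ (suc t) (*-monoʳ-≤ 2 (∸-monoʳ-≤ {1} {suc (pos H e)} k (s≤s z≤n)))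

    2∣p : ∀ u → 2 ∣ p u
    2∣p u = go (filter (incident? G u) H)
      where
      go : ∀ es → 2 ∣ ∑ L es
      go []       = 2 ∣0
      go (e ∷ es) = ∣m∣n⇒∣m+n (2∣h k s (pos H e)) (go es)

    h0+t≤p-w : h k t 0 + t ≤ p w
    h0+t≤p-w = begin
      h k t 0 + t                          ≤⟨ +-monoʳ-≤ (h k t 0) (≤-trans (n≤1+n t) (m≤m+n (suc t) _)) ⟩
      h k t 0 + h k t 1                    ≤⟨ +-monoʳ-≤ (h k t 0) (m≤m+n (h k t 1) _) ⟩
      h k t 0 + (h k t 1 + base (h k t) w) ≡⟨ partialSum-both (h k t) w∈e₁ w∈e₂ ⟨
      p w                                  ∎
      where open ≤-Reasoning

    big? : ∀ u → Dec (h k t 0 < p u)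
    big? u = h k t 0 <? p u

    big⇒deg≥2 : ∀ u → h k t 0 < p u → 2 ≤ length (filter (incident? G u) H)
    big⇒deg≥2 u big = go (filter (incident? G u) H) big
      where
      go : ∀ es → h k t 0 < ∑ L es → 2 ≤ length es
      go (e ∷ []) lt = contradiction (≤-trans lt (≤-trans (≤-reflexive (+-identityʳ (L e))) (L≤h0 e))) (<-irrefl refl)
      go (e ∷ e′ ∷ es) _ = s≤s (s≤s z≤n)

    #big<k : length (filter big? V) < k
    #big<k = *-cancelʳ-< 2 (length (filter big? V)) k (begin-strict
      length (filter big? V) * 2  ≤⟨ *-length-filter-≤-∑ big? deg 2 V (λ {u} _ → big⇒deg≥2 u) ⟩
      ∑ deg V                     ≤⟨ ∑V≤∑U ⟩
      ∑ deg U                     <⟨ m<m+n (∑ deg U) deg-w>0 ⟩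
      ∑ deg U + deg w             ≤⟨ handshake ⟩
      k * 2                       ∎)
      where
      open ≤-Reasoning
      deg : Fin n → ℕ
      deg u = length (filter (incident? G u) H)
      ∑V≤∑U : ∑ deg V ≤ ∑ deg U
      ∑V≤∑U with zs , q ← ⊆⇒↭++ V-unique V⊆U =
        ≤-trans (m≤m+n _ (∑ deg zs)) (≤-reflexive (sym (trans (∑-↭ deg q) (∑-++ deg V zs))))
      deg-w>0 : 0 < deg w
      deg-w>0 = subst (λ es → 0 < length es) (sym (filter-accept (incident? G w) w∈e₁)) (s≤s z≤n)

    big⇒rank<k : ∀ {u} → u ∈ V → h k t 0 < p u → rank u < k
    big⇒rank<k {u} i big = <-trans (rank<length-filter big? i big (λ {y} _ lt → ≤-trans big (key<⇒p≤ {u} {y} lt))) #big<k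

    -- An even label g i is below t and used at a vertex whose partial sum is at most h 0.
    even≢ : ∀ {z} → 2 ∣ z → h k t 0 + t ≤ z → ∀ {u} → u ∈ V → z ≢ LV u + p u
    even≢ {z} 2∣z le {u} i eq with rank u ≤? k
    ... | yes r≤k = g-odd k s r≤k (2∣p u) (subst (2 ∣_) eq 2∣z)
    ... | no  r≰k = <⇒≢ (begin-strict
            LV u + p u    <⟨ +-mono-<-≤ (g<t k t (≰⇒> r≰k) (rank< i))
                               (≮⇒≥ (λ big → r≰k (<⇒≤ (big⇒rank<k i big)))) ⟩
            t + h k t 0   ≡⟨ +-comm t (h k t 0) ⟩
            h k t 0 + t   ≤⟨ le ⟩
            z             ∎) (sym eq)
      where open ≤-Reasoning

    ∑L+k+t≤∑LV : ∑ L H + (k + t) ≤ ∑ LV V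
    ∑L+k+t≤∑LV = begin
      ∑ L H + (k + t)                  ≡⟨ cong (_+ (k + t)) (∑LH (h k t)) ⟩
      ∑ (h k t) (upTo k) + (k + t)     ≤⟨ ∑h+k+t≤∑g k t (s≤s z≤n) ⟩
      ∑ (g k t) (upTo (k + t))         ≡⟨ cong (λ r → ∑ (g k t) (upTo r)) ∣V∣ ⟨
      ∑ (g k t) (upTo (length V))      ≡⟨ ∑-reindex V-unique rank-injective′ rank<length (g k t) ⟨
      ∑ LV V                           ∎
      where open ≤-Reasoning

    L≢LV : ∀ {e u} → u ∈ V → L e ≢ LV u
    L≢LV {e} {u} i = h≢g k s {pos H e} {rank u} (rank< i)

  module AlternatingOdd
    (U : List (Fin n)) (U↭ : filter (v ~?_) (allFin n) ↭ U)
    (e₁ e₂ : Edge G) (rest : List (Edge G))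
    (H↭ : filter (∁? (incident? G v)) (edges G) ↭ e₁ ∷ e₂ ∷ rest)
    (w∈e₁ : Incident G w e₁) (w∈e₂ : Incident G w e₂)
    (s : ℕ) (∣U∣ : length U ≡ 2 + length rest + suc (2 * s))
    where
    open Alternating U U↭ e₁ e₂ rest H↭ w∈e₁ w∈e₂ U
      (Core.U-unique U U↭ (e₁ ∷ e₂ ∷ rest) H↭) (λ i → i) s ∣U∣

    oddAntimagic : 1 ≤ length rest + 2 * s → Antimagic G
    oddAntimagic large = antimagic L LV
      (λ {e} _ → s≤s z≤n , ≤-trans (L≤ e) (≤-reflexive (sym m≡)))
      (λ {u} i → 1≤g k t (rank< i) , ≤-trans (g≤ k t (rank u)) (≤-reflexive (sym m≡)))
      L-injective label-injective (λ {e} {u} _ → L≢LV {e} {u}) sum-injective (even≢ (2∣p w) h0+t≤p-w) <v w<v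
      where
      m≡ : ∣E∣ G ≡ (k + t) + k
      m≡ = trans ∣E∣≡ (cong (_+ k) ∣U∣)
      k<h1 : k < h k t 1
      k<h1 = ≤-trans (+-monoʳ-≤ 2 (+-monoˡ-≤ (length rest) large)) (≤-reflexive (eq (length rest) s))
        where
        eq : ∀ l s → 2 + (l + 2 * s + l) ≡ suc (suc (2 * s)) + 2 * l
        eq = solve-∀
      <v : ∀ {u} → u ∈ U → LV u + p u < ∑ LV U
      <v {u} i = begin-strict
        LV u + p u                ≤⟨ +-monoˡ-≤ (p u) (g≤ k t (rank u)) ⟩
        (k + t) + k + p u         <⟨ +-monoˡ-< (p u) (+-monoʳ-< (k + t) k<h1) ⟩
        (k + t) + h k t 1 + p u   ≡⟨ regroup (k + t) (h k t 1) (p u) ⟩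
        (p u + h k t 1) + (k + t) ≤⟨ +-monoˡ-≤ (k + t) (partialSum-omit (h k t) h1≤h0 (∈U⇒≢w i)) ⟩
        ∑ L H + (k + t)           ≤⟨ ∑L+k+t≤∑LV ⟩
        ∑ LV U                    ∎
        where
        open ≤-Reasoning
        regroup : ∀ a b c → a + b + c ≡ (c + b) + a
        regroup = solve-∀
      w<v : p w < ∑ LV U
      w<v = ≤-trans (s≤s (∑-filter-≤ (incident? G w) L H))
        (≤-trans (m<m+n (∑ L H) (s≤s z≤n)) ∑L+k+t≤∑LV)

  module AlternatingEven
    (x : Fin n) (V : List (Fin n)) (U↭ : filter (v ~?_) (allFin n) ↭ x ∷ V)
    (e₁ e₂ : Edge G) (rest : List (Edge G))
    (H↭ : filter (∁? (incident? G v)) (edges G) ↭ e₁ ∷ e₂ ∷ rest)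
    (w∈e₁ : Incident G w e₁) (w∈e₂ : Incident G w e₂)
    (s : ℕ) (∣V∣ : length V ≡ 2 + length rest + suc (2 * s))
    where
    private
      U = x ∷ V

      xV-unique : Unique U
      xV-unique = Core.U-unique U U↭ (e₁ ∷ e₂ ∷ rest) H↭

      V-unique : Unique V
      V-unique with _ ∷ u ← xV-unique = u

    open Alternating U U↭ e₁ e₂ rest H↭ w∈e₁ w∈e₂ V V-unique there s ∣V∣ public
      hiding (x; x∈e₁; x∈U; x∉e₂)

    m : ℕ
    m = suc ((k + t) + k)

    LU : Fin n → ℕ
    LU u with u ≟ x
    ... | yes _ = m
    ... | no  _ = LV u

    LU-x : LU x ≡ m
    LU-x with x ≟ x
    ... | yes _ = refl
    ... | no ¬p = contradiction refl ¬p

    LU-V : ∀ {u} → u ∈ V → LU u ≡ LV u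
    LU-V {u} i with u ≟ x
    ... | no _ = refl
    ... | yes refl with x∉V ∷ _ ← xV-unique = contradiction refl (All.lookup x∉V i)

    LU≤m : ∀ u → LU u ≤ m
    LU≤m u with u ≟ x
    ... | yes _ = ≤-refl
    ... | no  _ = m≤n⇒m≤1+n (g≤ k t (rank u))

    LV<m : ∀ u → LV u < m
    LV<m u = s≤s (g≤ k t (rank u))

    2∣m : 2 ∣ m
    2∣m = divides (k + suc s) (eq k s)
      where
      eq : ∀ k s → suc ((k + suc (2 * s)) + k) ≡ (k + suc s) * 2
      eq = solve-∀

    h0<m : h k t 0 < m
    h0<m = s≤s (h≤ k t 0 (s≤s z≤n))

    evenAntimagic : h k t 1 ≤ p x → p w ≢ m + p x → Antimagic G
    evenAntimagic h1≤p-x p-w≢ = antimagic L LU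
      (λ {e} _ → s≤s z≤n , ≤-trans (L≤ e) (≤-trans (n≤1+n _) (≤-reflexive (sym m≡))))
      (λ {u} i → 1≤LU i , ≤-trans (LU≤m u) (≤-reflexive (sym m≡)))
      L-injective injU disj distinct w≢ <v w<v
      where
      m≡ : ∣E∣ G ≡ m
      m≡ = trans ∣E∣≡ (cong (λ r → suc r + k) ∣V∣)
      1≤LU : ∀ {u} → u ∈ U → 1 ≤ LU u
      1≤LU (here refl) = subst (1 ≤_) (sym LU-x) (s≤s z≤n)
      1≤LU (there i)   = subst (1 ≤_) (sym (LU-V i)) (1≤g k t (rank< i))
      injU : ∀ {u u′} → u ∈ U → u′ ∈ U → LU u ≡ LU u′ → u ≡ u′
      injU (here refl) (here refl) eq = refl
      injU {u′ = u′} (here refl) (there j) eq = contradiction (trans (sym (LU-V j)) (trans (sym eq) LU-x)) (<⇒≢ (LV<m u′))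
      injU {u} (there i) (here refl) eq = contradiction (trans (sym (LU-V i)) (trans eq LU-x)) (<⇒≢ (LV<m u))
      injU (there i) (there j) eq = label-injective i j (trans (sym (LU-V i)) (trans eq (LU-V j)))
      disj : ∀ {e u} → e ∈ H → u ∈ U → L e ≢ LU u
      disj {e} _ (here refl) eq = <⇒≢ (≤-<-trans (L≤h0 e) h0<m) (trans eq LU-x)
      disj {e} _ (there i) eq = L≢LV {e} i (trans eq (LU-V i))
      2∣m+p : 2 ∣ m + p x
      2∣m+p = ∣m∣n⇒∣m+n 2∣m (2∣p x)
      h0+t≤m+p : h k t 0 + t ≤ m + p x
      h0+t≤m+p = +-mono-≤ (<⇒≤ h0<m) (≤-trans (≤-trans (n≤1+n t) (m≤m+n (suc t) _)) h1≤p-x)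
      sum-V : ∀ {u} → u ∈ V → LU u + p u ≡ LV u + p u
      sum-V {u} i = cong (_+ p u) (LU-V i)
      distinct : ∀ {u u′} → u ∈ U → u′ ∈ U → LU u + p u ≡ LU u′ + p u′ → u ≡ u′
      distinct (here refl) (here refl) eq = refl
      distinct (here refl) (there j) eq = contradiction
        (trans (cong (_+ p x) (sym LU-x)) (trans eq (sum-V j))) (even≢ 2∣m+p h0+t≤m+p j)
      distinct (there i) (here refl) eq = contradiction
        (trans (cong (_+ p x) (sym LU-x)) (trans (sym eq) (sum-V i))) (even≢ 2∣m+p h0+t≤m+p i)
      distinct (there i) (there j) eq = sum-injective i j (trans (sym (sum-V i)) (trans eq (sum-V j)))
      w≢ : ∀ {u} → u ∈ U → p w ≢ LU u + p u
      w≢ (here refl) eq = p-w≢ (trans eq (cong (_+ p x) LU-x))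
      w≢ (there i) eq = even≢ (2∣p w) h0+t≤p-w i (trans eq (sum-V i))
      m+∑L<∑LU : m + ∑ L H < ∑ LU U
      m+∑L<∑LU = begin-strict
        m + ∑ L H             <⟨ +-monoʳ-< m (≤-trans (m<m+n (∑ L H) (s≤s z≤n)) ∑L+k+t≤∑LV) ⟩
        m + ∑ LV V            ≡⟨ cong₂ _+_ LU-x (∑-cong V LU-V) ⟨
        ∑ LU U                ∎
        where open ≤-Reasoning
      <v : ∀ {u} → u ∈ U → LU u + p u < ∑ LU U
      <v {u} _ = ≤-<-trans (+-mono-≤ (LU≤m u) (∑-filter-≤ (incident? G u) L H)) m+∑L<∑LU
      w<v : p w < ∑ LU U
      w<v = ≤-<-trans (≤-trans (∑-filter-≤ (incident? G w) L H) (m≤n+m (∑ L H) m)) m+∑L<∑LU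

  -- For the 4-cycle with a pendant edge the alternating labels give v and a neighbour of w the same sum,
  -- 5 + 3 + 1 = 5 + 4.
  module Banner
    (U : List (Fin n)) (U↭ : filter (v ~?_) (allFin n) ↭ U)
    (e₁ e₂ : Edge G)
    (H↭ : filter (∁? (incident? G v)) (edges G) ↭ e₁ ∷ e₂ ∷ [])
    (w∈e₁ : Incident G w e₁) (w∈e₂ : Incident G w e₂)
    (∣U∣ : length U ≡ 3)
    where
    open TwoEdges U U↭ e₁ e₂ [] H↭ w∈e₁ w∈e₂

    h₅ g₅ : ℕ → ℕ
    h₅ 0       = 3
    h₅ (suc _) = 2
    g₅ 0             = 5
    g₅ 1             = 4
    g₅ (suc (suc _)) = 1

    L : E → ℕ
    L = LH h₅

    p : Fin n → ℕ
    p = partialSum L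

    open Decreasing p U

    g₅-antitone : ∀ {i j} → i < j → j < length U → g₅ j < g₅ i
    g₅-antitone {i} {j} i<j j<U with i | j | i<j | subst (j <_) ∣U∣ j<U
    ... | 0 | 1 | _ | _ = ≤-refl
    ... | 0 | 2 | _ | _ = s≤s (s≤s z≤n)
    ... | 1 | 2 | _ | _ = s≤s (s≤s z≤n)
    ... | 1 | 1 | s≤s () | _
    ... | suc (suc _) | 1 | s≤s () | _
    ... | suc (suc _) | 2 | s≤s (s≤s ()) | _
    ... | _ | suc (suc (suc _)) | _ | s≤s (s≤s (s≤s ()))

    open Labels g₅ g₅-antitone

    LU : Fin n → ℕ
    LU u = g₅ (rank u)

    p-x : p x ≡ 3
    p-x = partialSum-e₁ h₅ x∈e₁ x∉e₂

    p-w : p w ≡ 5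
    p-w = partialSum-both h₅ w∈e₁ w∈e₂

    p-values : ∀ {u} → u ∈ U → p u ≡ 0 ⊎ p u ≡ 2 ⊎ p u ≡ 3
    p-values {u} i with incident? G u e₁ | incident? G u e₂
    ... | yes a | yes b = contradiction b (not-both (∈U⇒≢w i) a)
    ... | yes a | no ¬b = inj₂ (inj₂ (partialSum-e₁ h₅ a ¬b))
    ... | no ¬a | yes b = inj₂ (inj₁ (partialSum-e₂ h₅ ¬a b))
    ... | no ¬a | no ¬b = inj₁ (partialSum-neither h₅ ¬a ¬b)

    first⇒3≤p : ∀ {u} → u ∈ U → rank u ≡ 0 → 3 ≤ p u
    first⇒3≤p {u} i eq = ≮⇒≥ (λ lt → n≮0 (subst (rank x <_) eq
      (rank-antitone {x} {u} x∈U (p<⇒key< {u} {x} (≤-trans lt (≤-reflexive (sym p-x)))))))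

    ∑LU : ∑ LU U ≡ 10
    ∑LU = trans (∑-reindex U-unique rank-injective′ rank<length g₅) (cong (λ r → ∑ g₅ (upTo r)) ∣U∣)

    m≡ : ∣E∣ G ≡ 5
    m≡ = trans ∣E∣≡ (cong (_+ 2) ∣U∣)

    bannerAntimagic : Antimagic G
    bannerAntimagic = antimagic L LU
      (λ {e} _ → subst (λ m → 1 ≤ L e × L e ≤ m) (sym m≡) (h₅-range (pos H e)))
      (λ {u} _ → subst (λ m → 1 ≤ LU u × LU u ≤ m) (sym m≡) (g₅-range (rank u)))
      (λ i j eq → pos-injective i j (h₅-injective (pos<length i) (pos<length j) eq))
      label-injective
      (λ {e} {u} _ _ → h₅≢g₅ (pos H e) (rank u))
      sum-injective w≢ <v
      (subst₂ _<_ (sym p-w) (sym ∑LU) (m≤m+n 6 4))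
      where
      h₅-range : ∀ i → 1 ≤ h₅ i × h₅ i ≤ 5
      h₅-range 0       = s≤s z≤n , m≤m+n 3 2
      h₅-range (suc _) = s≤s z≤n , m≤m+n 2 3
      g₅-range : ∀ i → 1 ≤ g₅ i × g₅ i ≤ 5
      g₅-range 0             = s≤s z≤n , ≤-refl
      g₅-range 1             = s≤s z≤n , m≤m+n 4 1
      g₅-range (suc (suc _)) = s≤s z≤n , m≤m+n 1 4
      h₅-injective : ∀ {i j} → i < 2 → j < 2 → h₅ i ≡ h₅ j → i ≡ j
      h₅-injective {0} {0} _ _ _ = refl
      h₅-injective {1} {1} _ _ _ = refl
      h₅-injective {suc (suc _)} (s≤s (s≤s ()))
      h₅-injective {j = suc (suc _)} _ (s≤s (s≤s ()))
      h₅≢g₅ : ∀ i j → h₅ i ≢ g₅ j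
      h₅≢g₅ 0       0             ()
      h₅≢g₅ 0       1             ()
      h₅≢g₅ 0       (suc (suc _)) ()
      h₅≢g₅ (suc _) 0             ()
      h₅≢g₅ (suc _) 1             ()
      h₅≢g₅ (suc _) (suc (suc _)) ()
      sum≢5 : ∀ r q → (r ≡ 0 → 3 ≤ q) → q ≡ 0 ⊎ q ≡ 2 ⊎ q ≡ 3 → 5 ≢ g₅ r + q
      sum≢5 0             _ f (inj₁ refl) _ with () ← f refl
      sum≢5 0             _ f (inj₂ (inj₁ refl)) ()
      sum≢5 0             _ f (inj₂ (inj₂ refl)) ()
      sum≢5 1             _ f (inj₁ refl) ()
      sum≢5 1             _ f (inj₂ (inj₁ refl)) ()
      sum≢5 1             _ f (inj₂ (inj₂ refl)) ()
      sum≢5 (suc (suc _)) _ f (inj₁ refl) ()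
      sum≢5 (suc (suc _)) _ f (inj₂ (inj₁ refl)) ()
      sum≢5 (suc (suc _)) _ f (inj₂ (inj₂ refl)) ()
      w≢ : ∀ {u} → u ∈ U → p w ≢ LU u + p u
      w≢ {u} i eq = sum≢5 (rank u) (p u) (first⇒3≤p i) (p-values i) (trans (sym p-w) eq)
      ≤3 : ∀ {q} → q ≡ 0 ⊎ q ≡ 2 ⊎ q ≡ 3 → q ≤ 3
      ≤3 (inj₁ refl)        = z≤n
      ≤3 (inj₂ (inj₁ refl)) = m≤m+n 2 1
      ≤3 (inj₂ (inj₂ refl)) = ≤-refl
      <v : ∀ {u} → u ∈ U → LU u + p u < ∑ LU U
      <v {u} i = ≤-trans (s≤s (+-mono-≤ (proj₂ (g₅-range (rank u))) (≤3 (p-values i))))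
        (≤-trans (m≤m+n 9 1) (≤-reflexive (sym ∑LU)))

  U₀ : List (Fin n)
  U₀ = filter (v ~?_) (allFin n)

  H₀ : List E
  H₀ = filter (∁? (incident? G v)) (edges G)

  open Core U₀ ↭-refl H₀ ↭-refl using (∣E∣≡; H-unique) public

  module _ (e₁ e₂ : E) (rest : List E) (H↭ : H₀ ↭ e₁ ∷ e₂ ∷ rest)
    (w∈e₁ : Incident G w e₁) (w∈e₂ : Incident G w e₂) where

    -- Exchanging the labels of e₁ and e₂ changes the partial sum of x but not that of w,
    -- so that one of the two labelings separates w from x.
    evenCase : ∀ s → length U₀ ≡ suc (2 + length rest + suc (2 * s)) → Antimagic G
    evenCase s ∣U₀∣ = choose (A.p w ℕ.≟ A.m + A.p x)
      where
      open TwoEdges U₀ ↭-refl e₁ e₂ rest H↭ w∈e₁ w∈e₂ using (x; x∈e₁; x∈U; x∉e₂)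
      x∷-U₀ : ∃ λ V → U₀ ↭ x ∷ V
      x∷-U₀ = ⊆⇒↭++ {xs = [ x ]} ([] ∷ []) (λ { (here refl) → x∈U })
      V : List (Fin n)
      V = proj₁ x∷-U₀
      U↭ : U₀ ↭ x ∷ V
      U↭ = proj₂ x∷-U₀
      ∣V∣ : length V ≡ 2 + length rest + suc (2 * s)
      ∣V∣ = suc-injective (trans (sym (↭-length U↭)) ∣U₀∣)
      H↭′ : H₀ ↭ e₂ ∷ e₁ ∷ rest
      H↭′ = ↭-trans H↭ (↭-swap e₁ e₂ ↭-refl)
      module A = AlternatingEven x V U↭ e₁ e₂ rest H↭ w∈e₁ w∈e₂ s ∣V∣
      module B = AlternatingEven x V U↭ e₂ e₁ rest H↭′ w∈e₂ w∈e₁ s ∣V∣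
      f : ℕ → ℕ
      f = h A.k A.t
      A-p-x : A.p x ≡ f 0 + A.base f x
      A-p-x = A.partialSum-e₁ f x∈e₁ x∉e₂
      B-p-x : B.p x ≡ f 1 + A.base f x
      B-p-x = B.partialSum-e₂ f x∉e₂ x∈e₁
      p-w≡ : B.p w ≡ A.p w
      p-w≡ = trans (B.partialSum-both f w∈e₂ w∈e₁) (sym (A.partialSum-both f w∈e₁ w∈e₂))
      f1≢f0 : f 1 ≢ f 0
      f1≢f0 eq with () ← h-injective A.k A.t (s≤s (s≤s z≤n)) (s≤s z≤n) eq
      choose : Dec (A.p w ≡ A.m + A.p x) → Antimagic G
      choose (no  ≢) = A.evenAntimagic (subst (f 1 ≤_) (sym A-p-x) (≤-trans A.h1≤h0 (m≤m+n (f 0) _))) ≢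
      choose (yes eq) = B.evenAntimagic (subst (f 1 ≤_) (sym B-p-x) (m≤m+n (f 1) _))
        (λ eq′ → f1≢f0 (+-cancelʳ-≡ (A.base f x) (f 1) (f 0)
          (trans (sym B-p-x) (trans (+-cancelˡ-≡ A.m _ _ (trans (sym eq′) (trans p-w≡ eq))) A-p-x))))

    highDegree : ∀ d → length U₀ ≡ 2 + length rest + suc d → Antimagic G
    highDegree d ∣U₀∣ with even-or-odd d
    ... | s , inj₂ refl = evenCase s (trans ∣U₀∣ (+-suc (2 + length rest) (suc (2 * s))))
    ... | s , inj₁ refl = oddCase rest H↭ s ∣U₀∣
      where
      oddCase : ∀ rest → H₀ ↭ e₁ ∷ e₂ ∷ rest → ∀ s → length U₀ ≡ 2 + length rest + suc (2 * s) → Antimagic G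
      oddCase [] H↭ zero ∣U₀∣ =
        Banner.bannerAntimagic U₀ ↭-refl e₁ e₂ H↭ w∈e₁ w∈e₂ ∣U₀∣
      oddCase [] H↭ (suc s) ∣U₀∣ =
        AlternatingOdd.oddAntimagic U₀ ↭-refl e₁ e₂ [] H↭ w∈e₁ w∈e₂ (suc s) ∣U₀∣ (s≤s z≤n)
      oddCase (e ∷ es) H↭ s ∣U₀∣ =
        AlternatingOdd.oddAntimagic U₀ ↭-refl e₁ e₂ (e ∷ es) H↭ w∈e₁ w∈e₂ s ∣U₀∣ (s≤s z≤n)

  sparse⇒antimagic : 2 ≤ length U₀ → length H₀ < length U₀ → Antimagic G
  sparse⇒antimagic 2≤r k<r = go (filter (incident? G w) H₀) refl
    where
    go : ∀ es → filter (incident? G w) H₀ ≡ es → Antimagic G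
    go [] eq = LowLabels.lowAntimagic k<r 2≤r (≤-trans (≤-reflexive (cong length eq)) z≤n)
    go (_ ∷ []) eq = LowLabels.lowAntimagic k<r 2≤r (≤-reflexive (cong length eq))
    go (e₁ ∷ e₂ ∷ es) eq = highDegree e₁ e₂ (proj₁ split) (proj₂ split)
        (proj₂ (at (here refl))) (proj₂ (at (there (here refl)))) (r ∸ suc k)
        (begin
          r                                           ≡⟨ m+[n∸m]≡n k<r ⟨
          suc k + (r ∸ suc k)                         ≡⟨ +-suc k (r ∸ suc k) ⟨
          k + suc (r ∸ suc k)                         ≡⟨ cong (_+ suc (r ∸ suc k)) (↭-length (proj₂ split)) ⟩
          2 + length (proj₁ split) + suc (r ∸ suc k)  ∎)
      where
      open ≡-Reasoning
      k r : ℕ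
      k = length H₀
      r = length U₀
      at : ∀ {e} → e ∈ e₁ ∷ e₂ ∷ es → e ∈ H₀ × Incident G w e
      at i = ∈-filter⁻ (incident? G w) (subst (_ ∈_) (sym eq) i)
      e₁≢e₂ : e₁ ≢ e₂
      e₁≢e₂ with (e₁≢e₂ ∷ _) ∷ _ ← subst Unique eq (Unique.filter⁺ (incident? G w) H-unique) = e₁≢e₂
      split : ∃ λ rest → H₀ ↭ e₁ ∷ e₂ ∷ rest
      split = ⊆⇒↭++ {xs = e₁ ∷ e₂ ∷ []} ((e₁≢e₂ ∷ []) ∷ [] ∷ [])
        (λ { (here refl) → proj₁ (at (here refl)) ; (there (here refl)) → proj₁ (at (there (here refl))) })

uniqueNonNeighbour⇒antimagic : ∀ r (G : Graph (2 + r)) v → degree G v ≡ r → 2 ≤ r → ∣E∣ G ≤ 2 * (2 + r) ∸ 5 →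
        (∃ λ w → v ≢ w × ¬ Graph._~_ G v w × (∀ a → a ≡ v ⊎ a ≡ w ⊎ Graph._~_ G v a)) → Antimagic G
uniqueNonNeighbour⇒antimagic r G v ∣U∣ 2≤r m≤ (w , v≢w , v≁w , cover) =
  sparse⇒antimagic (≤-trans 2≤r (≤-reflexive (sym ∣U∣))) (≤-trans k<r (≤-reflexive (sym ∣U∣)))
  where
  open OneNonNeighbour G v w v≢w v≁w cover
  2n≡ : ∀ r → 2 * (2 + r) ≡ 4 + (r + r)
  2n≡ = solve-∀
  k<r : length H₀ < r
  k<r = +-cancelˡ-< r (length H₀) r (begin-strict
    r + length H₀         ≡⟨ cong (_+ length H₀) ∣U∣ ⟨
    length U₀ + length H₀ ≡⟨ ∣E∣≡ ⟨
    ∣E∣ G                 ≤⟨ m≤ ⟩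
    2 * (2 + r) ∸ 5       ≡⟨ cong (_∸ 5) (2n≡ r) ⟩
    (r + r) ∸ 1           <⟨ ∸-monoʳ-< {r + r} {1} {0} (s≤s z≤n) (≤-trans (≤-trans (n≤1+n 1) 2≤r) (m≤m+n r r)) ⟩
    r + r                 ∎)
    where open ≤-Reasoning

lemma4p4 : (n : ℕ) (G : Graph n) → 4 ≤ n → Δ G ≡ n ∸ 2 → ∣E∣ G ≤ 2 * n ∸ 5 → Antimagic G
lemma4p4 (suc (suc r)) G (s≤s (s≤s 2≤r)) Δ≡r m≤ =
  uniqueNonNeighbour⇒antimagic r G v deg≡r 2≤r m≤ (oneNonNeighbour G (cong (2 +_) deg≡r))
  where
  max-degree : ∃ λ v → degree G v ≡ Δ G
  max-degree = Δ-attained G (≤-trans (≤-trans (n≤1+n 1) 2≤r) (≤-reflexive (sym Δ≡r)))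
  v : Fin (2 + r)
  v = proj₁ max-degree
  deg≡r : degree G v ≡ r
  deg≡r = trans (proj₂ max-degree) Δ≡r
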